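{- For any integer $g\ge 3$, there exists an oriented graph $D$ with maximum degree $\Delta(D)=1362$, ${\rm fas}(D)>a(D)/3$ and directed girth at least $g$. In particular, for every $g\ge 3$, ${\rm fas}(1362,g)>\frac13$ and ${\rm fasd}(1362,g)=2$.
   Context: An oriented graph is a digraph without loops, multiple arcs or directed $2$-cycles. Degree = in-degree + out-degree; directed girth = minimum length of a directed cycle ($\infty$ if none). ${\rm fas}(D)$ is the minimum size of a feedback arc set (arc set whose removal makes $D$ acyclic), $a(D)=|A(D)|$, and ${\rm fasd}(D)$ is the maximum number of feedback arc sets into which $A(D)$ can be partitioned ($\infty$ if $D$ acyclic). ${\rm fas}(\Delta,g)$ is the supremum of ${\rm fas}(D)/a(D)$ and ${\rm fasd}(\Delta,g)$ the minimum of ${\rm fasd}(D)$, both over oriented graphs $D$ (with at least one arc) of maximum degree at most $\Delta$ and directed girth at least $g$. -}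

module Defs where

open import Data.Nat using (ℕ; zero; suc; _+_; _*_; _≤_; _<_)
open import Data.Fin using (Fin; zero; suc; inject₁; fromℕ)
open import Data.Bool using (Bool; true; false; T; _∧_; if_then_else_)
open import Data.List using (map; allFin)
open import Data.Nat.ListAction using (sum)
open import Data.Empty using (⊥)
open import Data.Product using (Σ; _×_; ∃)
open import Relation.Nullary using (¬_)
open import Relation.Binary.PropositionalEquality using (_≡_)
open import Function.Definitions using (Injective)
open import Data.Fin using (_≟_)
open import Relation.Nullary.Decidable using (⌊_⌋)

record Digraph : Set where
  field
    n   : ℕ
    adj : Fin n → Fin n → Bool
open Digraph public

Arc : (D : Digraph) → Fin (n D) → Fin (n D) → Set
Arc D u v = T (adj D u v)

Oriented : Digraph → Set
Oriented D = (∀ u → ¬ Arc D u u) × (∀ u v → Arc D u v → ¬ Arc D v u)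

count : ∀ {k} → (Fin k → Bool) → ℕ
count {k} f = sum (map (λ i → if f i then 1 else 0) (allFin k))

outdeg indeg deg : (D : Digraph) → Fin (n D) → ℕ
outdeg D u = count (λ v → adj D u v)
indeg  D u = count (λ v → adj D v u)
deg    D u = outdeg D u + indeg D u

numArcs : Digraph → ℕ
numArcs D = sum (map (outdeg D) (allFin (n D)))

MaxDegreeEq : Digraph → ℕ → Set
MaxDegreeEq D Δ = (∀ u → deg D u ≤ Δ) × (∃ λ u → deg D u ≡ Δ)

MaxDegreeLe : Digraph → ℕ → Set
MaxDegreeLe D Δ = ∀ u → deg D u ≤ Δ

DirCycle : ∀ {N} → (Fin N → Fin N → Set) → ℕ → Set
DirCycle {N} R zero = ⊥
DirCycle {N} R (suc m) =
  Σ (Fin (suc m) → Fin N) λ f →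
    Injective _≡_ _≡_ f ×
    (∀ (i : Fin m) → R (f (inject₁ i)) (f (suc i))) ×
    R (f (fromℕ m)) (f zero)

Acyclic : ∀ {N} → (Fin N → Fin N → Set) → Set
Acyclic R = ∀ k → ¬ DirCycle R k

GirthAtLeast : Digraph → ℕ → Set
GirthAtLeast D g = ∀ k → DirCycle (Arc D) k → g ≤ k

ArcSubset : Digraph → Set
ArcSubset D = Fin (n D) → Fin (n D) → Bool

size : (D : Digraph) → ArcSubset D → ℕ
size D F = sum (map (λ u → count (λ v → F u v)) (allFin (n D)))

IsFAS : (D : Digraph) → ArcSubset D → Set
IsFAS D F = (∀ u v → T (F u v) → Arc D u v)
          × Acyclic (λ u v → Arc D u v × ¬ T (F u v))

FasGtThird : Digraph → Set
FasGtThird D = ∀ F → IsFAS D F → numArcs D < 3 * size D F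

FASPartition : Digraph → ℕ → Set
FASPartition D k =
  Σ (Fin (n D) → Fin (n D) → Fin k) λ c →
    ∀ (i : Fin k) → IsFAS D (λ u v → adj D u v ∧ ⌊ c u v ≟ i ⌋)

FasdAtLeast : Digraph → ℕ → Set
FasdAtLeast D k = FASPartition D k

-- fasd(D) ≤ k (in particular D is not acyclic)
FasdAtMost : Digraph → ℕ → Set
FasdAtMost D k = ∀ j → FASPartition D j → j ≤ k

-- the class of digraphs over which fas(Δ,g), fasd(Δ,g) range
Admissible : ℕ → ℕ → Digraph → Set
Admissible Δ g D = Oriented D × 0 < numArcs D × MaxDegreeLe D Δ × GirthAtLeast D g

{-# OPTIONS --safe #-}
module Submission where

-- The digraph is random; expectations are sums over all maps f : Fin m → Fin n.
-- Each of n = 8N vertices emits d = 128 slots whose heads f are independent and uniform.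
-- In expectation only O(1) slots start a short cycle or are parallel to another slot, and since the
-- in-degrees have variance at most d, few slots end at a vertex of in-degree above d + 4(d + 1).
-- Deleting all of these costs fewer than n of the dn slots for a suitable f.
-- If the removal of F leaves an acyclic digraph, cut a linear extension into 8 consecutive blocks of
-- size N: no remaining arc goes to an earlier block. For fixed blocks the number of slots that
-- do not descend is a sum of independent indicators, and bounding E 2^(that number), summed over at
-- most 8^n block labellings, shows that for a suitable f it is always below 84n. As 3 · 84 < 2 · 127,
-- fas > a/3 follows, with a surplus that pays for pendant arcs raising one degree to exactly 1362.

open import Defs renaming (n to order)
open import Data.Nat
open import Data.Nat.Properties
open import Data.Nat.GeneralisedArithmetic using (fold; fold-+)
open import Data.Nat.Tactic.RingSolver using (solve-∀)
import Data.Nat.ListAction as List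
open import Data.Fin as Fin
  using (Fin; zero; suc; inject₁; fromℕ; toℕ; quotient; combine; remQuot; punchIn; punchOut; _↑ˡ_; _↑ʳ_)
import Data.Fin.Properties as Fin
open import Data.Fin.Permutation
  using (Permutation; Permutation′; _⟨$⟩ʳ_; insert; insert-punchIn) renaming (id to idₚ)
open import Data.Fin.Relation.Unary.Top using (view; ‵fromℕ; ‵inject₁)
open import Data.Bool using (Bool; true; false; if_then_else_; T; _∧_)
open import Data.List using (map; allFin; tabulate)
open import Data.List.Properties using (map-tabulate)
open import Data.Product using (_×_; ∃; _,_; proj₁; proj₂)
open import Data.Sum using (_⊎_; inj₁; inj₂)
open import Data.Vec.Functional using (_∷_; [])
open import Relation.Nullary using (¬_; Dec; yes; no; does; contradiction)
open import Relation.Nullary.Decidable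
  using (_×-dec_; _→-dec_; ¬?; T?; dec-true; dec-false; decidable-stable; ⌊_⌋; fromWitness)
open import Relation.Binary using (tri<; tri≈; tri>)
open import Relation.Binary.PropositionalEquality
open import Function using (_∘_; id)
open import Function.Definitions using (Injective)
open import Algebra.Properties.Semiring.Sum +-*-semiring
  using (sum; sum-cong-≗; ∑-distrib-+; ∑-comm; ∑-permute; *-distribˡ-sum; *-distribʳ-sum)
open import Algebra.Properties.CommutativeMonoid.Sum *-1-commutativeMonoid
  using () renaming (sum to prod; sum-cong-≗ to prod-cong; ∑-distrib-+ to ∏-distrib-*; ∑-comm to ∏-comm)

private variable
  k l m n : ℕ
  P Q : Set

-- Finite sums and products

infix 5 sum-syntax prod-syntax

sum-syntax : ∀ n → (Fin n → ℕ) → ℕ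
sum-syntax _ = sum

syntax sum-syntax n (λ i → x) = ∑[ i < n ] x

prod-syntax : ∀ n → (Fin n → ℕ) → ℕ
prod-syntax _ = prod

syntax prod-syntax n (λ i → x) = ∏[ i < n ] x

χ : Dec P → ℕ
χ p? = if does p? then 1 else 0

χ-yes : (p? : Dec P) → P → χ p? ≡ 1
χ-yes p? p rewrite dec-true p? p = refl

χ-no : (p? : Dec P) → ¬ P → χ p? ≡ 0
χ-no p? ¬p rewrite dec-false p? ¬p = refl

χ-mono : (p? : Dec P) (q? : Dec Q) → (P → Q) → χ p? ≤ χ q?
χ-mono (yes p) q? f = ≤-reflexive (sym (χ-yes q? (f p)))
χ-mono (no _)  q? f = z≤n

χ-cong : (p? : Dec P) (q? : Dec Q) → (P → Q) → (Q → P) → χ p? ≡ χ q?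
χ-cong p? q? f g = ≤-antisym (χ-mono p? q? f) (χ-mono q? p? g)

χ-× : (p? : Dec P) (q? : Dec Q) → χ (p? ×-dec q?) ≡ χ p? * χ q?
χ-× (yes _) q? = sym (+-identityʳ _)
χ-× (no _)  q? = refl

sum-mono : {f g : Fin n → ℕ} → (∀ i → f i ≤ g i) → sum f ≤ sum g
sum-mono {zero}  f≤g = z≤n
sum-mono {suc n} f≤g = +-mono-≤ (f≤g zero) (sum-mono (f≤g ∘ suc))

term≤sum : (f : Fin n → ℕ) (i : Fin n) → f i ≤ sum f
term≤sum f zero    = m≤m+n _ _
term≤sum f (suc i) = ≤-trans (term≤sum (f ∘ suc) i) (m≤n+m _ _)

sum-const : ∀ n c → ∑[ i < n ] c ≡ n * c
sum-const zero    c = refl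
sum-const (suc n) c = cong (c +_) (sum-const n c)

prod-const : ∀ n c → ∏[ i < n ] c ≡ c ^ n
prod-const zero    c = refl
prod-const (suc n) c = cong (c *_) (prod-const n c)

sum-δ : (i : Fin n) (f : Fin n → ℕ) → ∑[ j < n ] χ (i Fin.≟ j) * f j ≡ f i
sum-δ {suc n} zero    f = trans (cong₂ _+_ (*-identityˡ (f zero)) (trans (sum-const n 0) (*-zeroʳ n)))
    (+-identityʳ _)
sum-δ {suc n} (suc i) f = trans (sum-cong-≗ λ j →
    cong (_* f (suc j)) (χ-cong (suc i Fin.≟ suc j) (i Fin.≟ j) Fin.suc-injective (cong suc)))
    (sum-δ i (f ∘ suc))

-- An indicator in the exponent selects one factor and turns all others into 1. This lets a product
-- over chosen positions be rewritten as a product over all coordinates.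
prod-δ : (i : Fin n) (f : Fin n → ℕ) → ∏[ j < n ] f j ^ χ (i Fin.≟ j) ≡ f i
prod-δ {suc n} zero    f = trans (cong₂ _*_ (*-identityʳ (f zero)) (trans (prod-const n 1) (^-zeroˡ n)))
    (*-identityʳ _)
prod-δ {suc n} (suc i) f = trans (+-identityʳ _)
    (trans (prod-cong λ j → cong (f (suc j) ^_)
    (χ-cong (suc i Fin.≟ suc j) (i Fin.≟ j) Fin.suc-injective (cong suc))) (prod-δ i (f ∘ suc)))

^-sum : ∀ x (e : Fin n → ℕ) → x ^ sum e ≡ ∏[ i < n ] x ^ e i
^-sum {zero}  x e = refl
^-sum {suc n} x e = trans (^-distribˡ-+-* x (e zero) _) (cong (x ^ e zero *_) (^-sum x (e ∘ suc)))

^-distribʳ-* : ∀ x y e → (x * y) ^ e ≡ x ^ e * y ^ e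
^-distribʳ-* x y zero    = refl
^-distribʳ-* x y (suc e) = trans (cong (x * y *_) (^-distribʳ-* x y e))
    ([m*n]*[o*p]≡[m*o]*[n*p] x y (x ^ e) (y ^ e))

^-prod : ∀ (f : Fin n → ℕ) e → (prod f) ^ e ≡ ∏[ i < n ] f i ^ e
^-prod {zero}  f e = ^-zeroˡ e
^-prod {suc n} f e = trans (^-distribʳ-* (f zero) _ e) (cong (f zero ^ e *_) (^-prod (f ∘ suc) e))

fiber : (Fin m → Fin n) → Fin n → ℕ
fiber {m} c j = ∑[ u < m ] χ (c u Fin.≟ j)

sum-fibers : (c : Fin m → Fin n) (G : Fin n → ℕ) →
             ∑[ u < m ] G (c u) ≡ ∑[ j < n ] fiber c j * G j
sum-fibers {m} {n} c G = begin
  ∑[ u < m ] G (c u)                                  ≡⟨ sum-cong-≗ (λ u → sum-δ (c u) G) ⟨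
  ∑[ u < m ] ∑[ j < n ] χ (c u Fin.≟ j) * G j         ≡⟨ ∑-comm (λ u j → χ (c u Fin.≟ j) * G j) ⟩
  ∑[ j < n ] ∑[ u < m ] χ (c u Fin.≟ j) * G j
      ≡⟨ sum-cong-≗ (λ j → *-distribʳ-sum (G j) (λ u → χ (c u Fin.≟ j))) ⟨
  ∑[ j < n ] fiber c j * G j                          ∎
  where open ≡-Reasoning

prod-fibers : (c : Fin m → Fin n) (G : Fin n → ℕ) →
              ∏[ u < m ] G (c u) ≡ ∏[ j < n ] G j ^ fiber c j
prod-fibers {m} {n} c G = begin
  ∏[ u < m ] G (c u)                                  ≡⟨ prod-cong (λ u → prod-δ (c u) G) ⟨
  ∏[ u < m ] ∏[ j < n ] G j ^ χ (c u Fin.≟ j)         ≡⟨ ∏-comm (λ u j → G j ^ χ (c u Fin.≟ j)) ⟩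
  ∏[ j < n ] ∏[ u < m ] G j ^ χ (c u Fin.≟ j)
      ≡⟨ prod-cong (λ j → ^-sum (G j) (λ u → χ (c u Fin.≟ j))) ⟨
  ∏[ j < n ] G j ^ fiber c j                          ∎
  where open ≡-Reasoning

-- Expectations over uniformly random maps

-- n ^ m times the expectation of Φ over a uniformly random map.
sumMaps : ∀ m → ((Fin m → Fin n) → ℕ) → ℕ
sumMaps         zero    Φ = Φ λ ()
sumMaps {n = n} (suc m) Φ = ∑[ v < n ] sumMaps m (λ f → Φ (v ∷ f))

sumMaps-cong : ∀ m {Φ Ψ : (Fin m → Fin n) → ℕ} → (∀ f → Φ f ≡ Ψ f) → sumMaps m Φ ≡ sumMaps m Ψ
sumMaps-cong zero    eq = eq _
sumMaps-cong (suc m) eq = sum-cong-≗ λ v → sumMaps-cong m λ f → eq (v ∷ f)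

sumMaps-mono : ∀ m {Φ Ψ : (Fin m → Fin n) → ℕ} → (∀ f → Φ f ≤ Ψ f) → sumMaps m Φ ≤ sumMaps m Ψ
sumMaps-mono zero    le = le _
sumMaps-mono (suc m) le = sum-mono λ v → sumMaps-mono m λ f → le (v ∷ f)

sumMaps-+ : ∀ m (Φ Ψ : (Fin m → Fin n) → ℕ) →
            sumMaps m (λ f → Φ f + Ψ f) ≡ sumMaps m Φ + sumMaps m Ψ
sumMaps-+ zero    Φ Ψ = refl
sumMaps-+ (suc m) Φ Ψ =
  trans (sum-cong-≗ λ v → sumMaps-+ m (Φ ∘ (v ∷_)) (Ψ ∘ (v ∷_)))
        (∑-distrib-+ (λ v → sumMaps m (Φ ∘ (v ∷_))) (λ v → sumMaps m (Ψ ∘ (v ∷_))))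

sumMaps-*ˡ : ∀ m c (Φ : (Fin m → Fin n) → ℕ) → sumMaps m (λ f → c * Φ f) ≡ c * sumMaps m Φ
sumMaps-*ˡ zero    c Φ = refl
sumMaps-*ˡ (suc m) c Φ =
  trans (sum-cong-≗ λ v → sumMaps-*ˡ m c (Φ ∘ (v ∷_)))
        (sym (*-distribˡ-sum c (λ v → sumMaps m (Φ ∘ (v ∷_)))))

sumMaps-sum : ∀ m (Φ : Fin k → (Fin m → Fin n) → ℕ) →
              sumMaps m (λ f → ∑[ i < k ] Φ i f) ≡ ∑[ i < k ] sumMaps m (Φ i)
sumMaps-sum zero    Φ = refl
sumMaps-sum (suc m) Φ =
  trans (sum-cong-≗ λ v → sumMaps-sum m (λ i → Φ i ∘ (v ∷_)))
        (∑-comm (λ v i → sumMaps m (Φ i ∘ (v ∷_))))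

sumMaps-comm : ∀ m l (Φ : (Fin m → Fin n) → (Fin l → Fin k) → ℕ) →
               sumMaps m (λ f → sumMaps l (Φ f)) ≡ sumMaps l (λ c → sumMaps m (λ f → Φ f c))
sumMaps-comm m zero    Φ = refl
sumMaps-comm m (suc l) Φ =
  trans (sumMaps-sum m (λ v f → sumMaps l (Φ f ∘ (v ∷_))))
        (sum-cong-≗ λ v → sumMaps-comm m l (λ f → Φ f ∘ (v ∷_)))

sumMaps-const : ∀ m c → sumMaps {n} m (λ _ → c) ≡ n ^ m * c
sumMaps-const         zero    c = sym (+-identityʳ c)
sumMaps-const {n = n} (suc m) c = trans (trans (sum-cong-≗ λ (_ : Fin n) → sumMaps-const m c) (sum-const n _))
    (sym (*-assoc n _ c))

-- Independence of the values of a random map: functions of separate coordinates have a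
-- multiplicative expectation.
sumMaps-prod : ∀ m (h : Fin m → Fin n → ℕ) →
               sumMaps m (λ f → ∏[ s < m ] h s (f s)) ≡ ∏[ s < m ] ∑[ v < n ] h s v
sumMaps-prod         zero    h = refl
sumMaps-prod {n = n} (suc m) h = begin
  ∑[ v < n ] sumMaps m (λ f → h zero v * (∏[ s < m ] h (suc s) (f s)))
      ≡⟨ sum-cong-≗ (λ v → sumMaps-*ˡ m (h zero v) _) ⟩
  ∑[ v < n ] h zero v * sumMaps m (λ f → ∏[ s < m ] h (suc s) (f s))  ≡⟨ *-distribʳ-sum _ (h zero) ⟨
  sum (h zero) * sumMaps m (λ f → ∏[ s < m ] h (suc s) (f s))
      ≡⟨ cong (sum (h zero) *_) (sumMaps-prod m (h ∘ suc)) ⟩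
  ∏[ s < suc m ] ∑[ v < n ] h s v                                     ∎
  where open ≡-Reasoning

sum<⇒∃< : (f : Fin n → ℕ) (c : ℕ) → sum f < n * c → ∃ λ i → f i < c
sum<⇒∃< {suc n} f c lt with f zero <? c
... | yes p = zero , p
... | no ¬p with sum<⇒∃< (f ∘ suc) c (+-cancelˡ-< c _ _ (≤-<-trans (+-monoˡ-≤ _ (≮⇒≥ ¬p)) lt))
...   | i , q = suc i , q

-- First moment method: some value of the first coordinate keeps the conditional mean below `c`, so
-- the coordinates can be fixed one at a time.
averaging : ∀ m (Φ : (Fin m → Fin n) → ℕ) (c : ℕ) → sumMaps m Φ < n ^ m * c → ∃ λ f → Φ f < c
averaging         zero    Φ c lt = _ , <-≤-trans lt (≤-reflexive (+-identityʳ c))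
averaging {n = n} (suc m) Φ c lt
  with sum<⇒∃< (λ v → sumMaps m (Φ ∘ (v ∷_))) (n ^ m * c) (subst (sumMaps (suc m) Φ <_) (*-assoc n _ c) lt)
... | v , lt′ with averaging m (Φ ∘ (v ∷_)) c lt′
...   | f , p = v ∷ f , p

-- Extensionality of `Φ` is assumed because `sumMaps` evaluates it only at maps assembled with
-- `_∷_`, to which `f` is equal merely pointwise.
term≤sumMaps : ∀ m (Φ : (Fin m → Fin n) → ℕ) → (∀ {f g} → f ≗ g → Φ f ≤ Φ g) →
               ∀ f → Φ f ≤ sumMaps m Φ
term≤sumMaps zero    Φ ext f = ext λ ()
term≤sumMaps (suc m) Φ ext f = begin
  Φ f                                   ≤⟨ ext (λ { zero → refl ; (suc _) → refl }) ⟩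
  Φ (f zero ∷ f ∘ suc)                  ≤⟨ term≤sumMaps m (Φ ∘ (f zero ∷_))
      (λ eq → ext λ { zero → refl ; (suc i) → eq i }) (f ∘ suc) ⟩
  sumMaps m (Φ ∘ (f zero ∷_))           ≤⟨ term≤sum (λ v → sumMaps m (Φ ∘ (v ∷_))) (f zero) ⟩
  sumMaps (suc m) Φ                     ∎
  where open ≤-Reasoning

-- Distinct positions are independent, so `l` prescribed values occur together with probability 1 /
-- n^l. Spreading each position over all coordinates by `prod-δ` makes both factors products over
-- `r`: a coordinate hit by `s` contributes n · 1, any other 1 · n.
prescribed : (s : Fin l → Fin m) (w : Fin l → Fin n) → Injective _≡_ _≡_ s →
             n ^ l * sumMaps m (λ f → ∏[ t < l ] χ (f (s t) Fin.≟ w t)) ≡ n ^ m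
prescribed {l} {m} {n} s w inj = begin
  n ^ l * sumMaps m (λ f → ∏[ t < l ] χ (f (s t) Fin.≟ w t))
    ≡⟨ cong₂ _*_ weights (sumMaps-cong m λ f →
        trans (prod-cong λ t → sym (prod-δ (s t) (λ r → χ (f r Fin.≟ w t))))
        (∏-comm (λ t r → χ (f r Fin.≟ w t) ^ χ (s t Fin.≟ r)))) ⟩
  (∏[ r < m ] ∏[ t < l ] n ^ χ (s t Fin.≟ r)) * sumMaps m (λ f → ∏[ r < m ] h r (f r))
    ≡⟨ cong ((∏[ r < m ] ∏[ t < l ] n ^ χ (s t Fin.≟ r)) *_) (sumMaps-prod m h) ⟩
  (∏[ r < m ] ∏[ t < l ] n ^ χ (s t Fin.≟ r)) * (∏[ r < m ] ∑[ v < n ] h r v)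
    ≡⟨ ∏-distrib-* (λ r → ∏[ t < l ] n ^ χ (s t Fin.≟ r)) (λ r → ∑[ v < n ] h r v) ⟨
  ∏[ r < m ] (∏[ t < l ] n ^ χ (s t Fin.≟ r)) * (∑[ v < n ] h r v)
    ≡⟨ prod-cong factor ⟩
  ∏[ r < m ] n
    ≡⟨ prod-const m n ⟩
  n ^ m ∎
  where
  open ≡-Reasoning
  h : Fin m → Fin n → ℕ
  h r v = ∏[ t < l ] χ (v Fin.≟ w t) ^ χ (s t Fin.≟ r)
  weights : n ^ l ≡ ∏[ r < m ] ∏[ t < l ] n ^ χ (s t Fin.≟ r)
  weights = trans (sym (prod-const l n)) (trans (prod-cong λ t → sym (prod-δ (s t) (λ _ → n)))
      (∏-comm (λ t r → n ^ χ (s t Fin.≟ r))))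
  factor : ∀ r → (∏[ t < l ] n ^ χ (s t Fin.≟ r)) * (∑[ v < n ] h r v) ≡ n
  factor r with Fin.any? (λ t → s t Fin.≟ r)
  ... | yes (t₀ , st₀≡r) = begin
    (∏[ t < l ] n ^ χ (s t Fin.≟ r)) * (∑[ v < n ] h r v)
        ≡⟨ cong₂ _*_ (sift (λ _ → n)) (sum-cong-≗ λ v → sift (λ t → χ (v Fin.≟ w t))) ⟩
    n * (∑[ v < n ] χ (v Fin.≟ w t₀))
        ≡⟨ cong (n *_) (sum-cong-≗ λ v → trans (χ-cong (v Fin.≟ w t₀) (w t₀ Fin.≟ v) sym sym)
        (sym (*-identityʳ _))) ⟩
    n * (∑[ v < n ] χ (w t₀ Fin.≟ v) * 1)                  ≡⟨ cong (n *_) (sum-δ (w t₀) (λ _ → 1)) ⟩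
    n * 1                                                  ≡⟨ *-identityʳ n ⟩
    n                                                      ∎
    where
    sift : (x : Fin l → ℕ) → ∏[ t < l ] x t ^ χ (s t Fin.≟ r) ≡ x t₀
    sift x = trans (prod-cong λ t → cong (x t ^_)
        (χ-cong (s t Fin.≟ r) (t₀ Fin.≟ t) (λ eq → inj (trans st₀≡r (sym eq))) (λ { refl → st₀≡r })))
        (prod-δ t₀ x)
  ... | no ∄t = begin
    (∏[ t < l ] n ^ χ (s t Fin.≟ r)) * (∑[ v < n ] h r v)
        ≡⟨ cong₂ _*_ (trivial (λ _ → n)) (trans (sum-cong-≗ λ v → trivial (λ t → χ (v Fin.≟ w t)))
        (sum-const n 1)) ⟩
    1 * (n * 1)                                            ≡⟨ trans (*-identityˡ _) (*-identityʳ n) ⟩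
    n                                                      ∎
    where
    trivial : (x : Fin l → ℕ) → ∏[ t < l ] x t ^ χ (s t Fin.≟ r) ≡ 1
    trivial x = trans (prod-cong λ t → cong (x t ^_) (χ-no (s t Fin.≟ r) λ eq → ∄t (t , eq)))
        (trans (prod-const l 1) (^-zeroˡ l))

-- Split by the common value `w` and apply `prescribed` to the two positions; the collision
-- probability is 1/n.
collision : (s t : Fin m) → s ≢ t → n * sumMaps {n} m (λ f → χ (f s Fin.≟ f t)) ≡ n ^ m
-- With an empty codomain both sides vanish: `s` shows that `m` is positive.
collision {m} {zero}  s t s≢t = sym (0^ s)
  where
  0^ : ∀ {m} → Fin m → 0 ^ m ≡ 0
  0^ zero    = refl
  0^ (suc _) = refl
collision {m} {n@(suc _)} s t s≢t = *-cancelˡ-≡ _ _ n (begin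
  n * (n * sumMaps m (λ f → χ (f s Fin.≟ f t)))        ≡⟨ *-assoc n n _ ⟨
  n * n * sumMaps m (λ f → χ (f s Fin.≟ f t))
      ≡⟨ cong₂ _*_ (cong (n *_) (sym (*-identityʳ n))) (trans (sumMaps-cong m split) (sumMaps-sum m both)) ⟩
  n ^ 2 * (∑[ w < n ] sumMaps m (both w))              ≡⟨ *-distribˡ-sum (n ^ 2) (λ w → sumMaps m (both w)) ⟩
  ∑[ w < n ] n ^ 2 * sumMaps m (both w)
      ≡⟨ sum-cong-≗ (λ w → prescribed (s ∷ t ∷ []) (λ _ → w) inj) ⟩
  ∑[ w < n ] n ^ m                                     ≡⟨ sum-const n (n ^ m) ⟩
  n * n ^ m                                            ∎)
  where
  open ≡-Reasoning
  both : Fin n → (Fin m → Fin n) → ℕ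
  both w f = ∏[ i < 2 ] χ (f ((s ∷ t ∷ []) i) Fin.≟ w)
  split : ∀ f → χ (f s Fin.≟ f t) ≡ ∑[ w < n ] both w f
  split f = sym (trans (sum-cong-≗ λ w → cong (χ (f s Fin.≟ w) *_) (*-identityʳ (χ (f t Fin.≟ w))))
      (trans (sum-δ (f s) (λ w → χ (f t Fin.≟ w))) (χ-cong (f t Fin.≟ f s) (f s Fin.≟ f t) sym sym)))
  inj : Injective _≡_ _≡_ (s ∷ t ∷ [])
  inj {zero}     {zero}     _  = refl
  inj {zero}     {suc zero} eq = contradiction eq s≢t
  inj {suc zero} {zero}     eq = contradiction (sym eq) s≢t
  inj {suc zero} {suc zero} _  = refl

-- Random heads

-- Cyclic successor, so that the steps of a `DirCycle` and its closing arc can be treated alike.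
next : Fin (suc l) → Fin (suc l)
next i with view i
... | ‵fromℕ     = zero
... | ‵inject₁ j = suc j

injective? : (s : Fin l → Fin m) → Dec (∀ i j → s i ≡ s j → i ≡ j)
injective? s = Fin.all? λ i → Fin.all? λ j → (s i Fin.≟ s j) →-dec (i Fin.≟ j)

Balanced : ℕ → (Fin n → Fin k) → Set
Balanced N c = ∀ j → fiber c j ≡ N

balanced? : ∀ N (c : Fin n → Fin k) → Dec (Balanced N c)
balanced? N c = Fin.all? λ j → fiber c j ≟ N

fiber-cong : {c c′ : Fin m → Fin n} → c ≗ c′ → fiber c ≗ fiber c′
fiber-cong eq j = sum-cong-≗ λ u → cong (λ v → χ (v Fin.≟ j)) (eq u)

sum-fiber : (c : Fin m → Fin n) → sum (fiber c) ≡ m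
sum-fiber {m} c = begin
  sum (fiber c)              ≡⟨ sum-cong-≗ (λ j → *-identityʳ (fiber c j)) ⟨
  ∑[ j < _ ] fiber c j * 1   ≡⟨ sum-fibers c (λ _ → 1) ⟨
  ∑[ u < m ] 1               ≡⟨ trans (sum-const m 1) (*-identityʳ m) ⟩
  m                          ∎
  where open ≡-Reasoning

sumMaps-∑-≤ : (Φ : Fin k → (Fin m → Fin n) → ℕ) (a : Fin k → ℕ) → (∀ i → sumMaps m (Φ i) ≤ a i) →
              sumMaps m (λ f → ∑[ i < k ] Φ i f) ≤ sum a
sumMaps-∑-≤ Φ a le = ≤-trans (≤-reflexive (sumMaps-sum _ Φ)) (sum-mono le)

sumMaps-χ-≤ : ∀ m (p? : Dec P) (Φ : (Fin m → Fin n) → ℕ) {a b : ℕ} → (P → a * sumMaps m Φ ≤ b) →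
              a * sumMaps m (λ f → χ p? * Φ f) ≤ b
sumMaps-χ-≤ m (yes p) Φ {a} h = ≤-trans (≤-reflexive (cong (a *_) (sumMaps-cong m λ f → *-identityˡ (Φ f))))
    (h p)
sumMaps-χ-≤ {n = n} m (no _) Φ {a} h =
  ≤-trans (≤-reflexive (trans (cong (a *_) (trans (sumMaps-const {n} m 0) (*-zeroʳ (n ^ m)))) (*-zeroʳ a)))
      z≤n

*χ-≤ : (p? : Dec P) {x y : ℕ} → (P → x ≤ y) → x * χ p? ≤ y
*χ-≤ (yes p) {x} h = ≤-trans (≤-reflexive (*-identityʳ x)) (h p)
*χ-≤ (no _)  {x} h = ≤-trans (≤-reflexive (*-zeroʳ x)) z≤n

-- Expansion of (x - d)², with the cross term kept on the left to avoid truncated subtraction.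
dist-square : ∀ x d → ∣ x - d ∣ * ∣ x - d ∣ + 2 * d * x ≡ x * x + d * d
dist-square zero    d       = trans (cong (d * d +_) (*-zeroʳ (2 * d))) (+-comm (d * d) 0)
dist-square (suc x) zero    = refl
dist-square (suc x) (suc d) = trans (lhs (∣ x - d ∣) x d)
    (trans (cong (_+ 2 * (1 + d + x)) (dist-square x d)) (rhs x d))
  where
  lhs : ∀ e x d → e * e + 2 * suc d * suc x ≡ e * e + 2 * d * x + 2 * (1 + d + x)
  lhs = solve-∀
  rhs : ∀ x d → x * x + d * d + 2 * (1 + d + x) ≡ suc x * suc x + suc d * suc d
  rhs = solve-∀

-- upWeight k i / k is the expectation of 2 ^ [ i ≤ j ] for a uniformly random label j.
upWeight : ∀ k → Fin k → ℕ
upWeight k i = ∑[ j < k ] 2 ^ χ (i Fin.≤? j)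

-- `τ` gives the fixed tail of each slot; the maps `f` below give the random heads.
module Slots {m n : ℕ} (τ : Fin m → Fin n) where

  slotCycle : (Fin m → Fin n) → (Fin (suc l) → Fin m) → ℕ
  slotCycle {l} f s = χ (injective? s) * (∏[ t < suc l ] χ (f (s t) Fin.≟ τ (s (next t))))

  slotCyclesAt : ℕ → (Fin m → Fin n) → Fin m → ℕ
  slotCyclesAt l f r = sumMaps (suc l) λ s → χ (s zero Fin.≟ r) * slotCycle f s

  -- The index `l` stands for length `l + 1`, so lengths 1 to `g` are covered.
  shortness : ℕ → (Fin m → Fin n) → Fin m → ℕ
  shortness g f r = ∑[ l < g ] slotCyclesAt (toℕ l) f r

  parallel? : (s t : Fin m) → Dec (s ≢ t × τ s ≡ τ t)
  parallel? s t = ¬? (s Fin.≟ t) ×-dec (τ s Fin.≟ τ t)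

  multiplicity : (Fin m → Fin n) → Fin m → ℕ
  multiplicity f s = ∑[ t < m ] χ (parallel? s t) * χ (f s Fin.≟ f t)

  crowding : ℕ → (Fin m → Fin n) → Fin m → ℕ
  crowding M f s = χ (M <? fiber f (f s))

  -- Slots of nonzero penalty are deleted, so the total penalty bounds the number of deletions.
  penalty : ℕ → ℕ → (Fin m → Fin n) → Fin m → ℕ
  penalty g M f s = shortness g f s + multiplicity f s + crowding M f s

  sum-slotCyclesAt : ∀ l f → sum (slotCyclesAt l f) ≡ sumMaps (suc l) (slotCycle f)
  sum-slotCyclesAt l f = trans (sym (sumMaps-sum (suc l) (λ r s → χ (s zero Fin.≟ r) * slotCycle f s)))
                               (sumMaps-cong (suc l) λ s → sum-δ (s zero) (λ _ → slotCycle f s))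

  ascents : (Fin m → Fin n) → (Fin n → Fin k) → ℕ
  ascents f c = ∑[ s < m ] χ (c (τ s) Fin.≤? c (f s))

  labelWeight : ℕ → (Fin m → Fin n) → (Fin n → Fin k) → ℕ
  labelWeight N f c = χ (balanced? N c) * 2 ^ ascents f c

  module Regular {d : ℕ} (regular : ∀ u → fiber τ u ≡ d) where

    m≡n*d : m ≡ n * d
    m≡n*d = trans (sym (sum-fiber τ)) (trans (sum-cong-≗ regular) (sum-const n d))

    variance : (Fin m → Fin n) → ℕ
    variance f = ∑[ v < n ] ∣ fiber f v - d ∣ * ∣ fiber f v - d ∣

    module _ .{{_ : NonZero n}} where

      -- There are (n d)^(l+1) sequences of `l + 1` slots, and each closes up with probability at
      -- most 1 / n^(l+1). The resulting mean does not grow with `n`.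
      mean-slotCycles : ∀ l → sumMaps m (λ f → sum (slotCyclesAt l f)) ≤ n ^ m * d ^ suc l
      mean-slotCycles l = *-cancelˡ-≤ (n ^ suc l) {{m^n≢0 n (suc l)}} (begin
        n ^ suc l * sumMaps m (λ f → sum (slotCyclesAt l f))
          ≡⟨ cong (n ^ suc l *_) (trans (sumMaps-cong m (sum-slotCyclesAt l))
              (sumMaps-comm m (suc l) slotCycle)) ⟩
        n ^ suc l * sumMaps (suc l) (λ s → sumMaps m (λ f → slotCycle f s))
          ≡⟨ sumMaps-*ˡ {n = m} (suc l) (n ^ suc l) (λ s → sumMaps m (λ f → slotCycle f s)) ⟨
        sumMaps (suc l) (λ s → n ^ suc l * sumMaps m (λ f → slotCycle f s))
          ≤⟨ sumMaps-mono (suc l) single ⟩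
        sumMaps {m} (suc l) (λ s → n ^ m)
          ≡⟨ sumMaps-const {m} (suc l) (n ^ m) ⟩
        m ^ suc l * n ^ m
          ≡⟨ cong (λ x → x ^ suc l * n ^ m) m≡n*d ⟩
        (n * d) ^ suc l * n ^ m
          ≡⟨ cong (_* n ^ m) (^-distribʳ-* n d (suc l)) ⟩
        n ^ suc l * d ^ suc l * n ^ m
          ≡⟨ trans (*-assoc (n ^ suc l) _ _) (cong (n ^ suc l *_) (*-comm (d ^ suc l) (n ^ m))) ⟩
        n ^ suc l * (n ^ m * d ^ suc l) ∎)
        where
        open ≤-Reasoning
        single : ∀ s → n ^ suc l * sumMaps m (λ f → slotCycle f s) ≤ n ^ m
        single s = sumMaps-χ-≤ m (injective? s) (λ f → ∏[ t < suc l ] χ (f (s t) Fin.≟ τ (s (next t))))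
            {n ^ suc l} λ inj →
          ≤-reflexive (prescribed s (τ ∘ s ∘ next) (inj _ _))

      mean-shortness : ∀ g → sumMaps m (λ f → sum (shortness g f)) ≤ n ^ m * (∑[ l < g ] d ^ suc (toℕ l))
      mean-shortness g = begin
        sumMaps m (λ f → sum (shortness g f))
          ≡⟨ sumMaps-cong m (λ f → ∑-comm {m} {g} (λ r l → slotCyclesAt (toℕ l) f r)) ⟩
        sumMaps m (λ f → ∑[ l < g ] sum (slotCyclesAt (toℕ l) f))
          ≤⟨ sumMaps-∑-≤ {k = g} (λ l f → sum (slotCyclesAt (toℕ l) f)) _ (λ l → mean-slotCycles (toℕ l)) ⟩
        ∑[ l < g ] n ^ m * d ^ suc (toℕ l)
          ≡⟨ *-distribˡ-sum {g} (n ^ m) (λ l → d ^ suc (toℕ l)) ⟨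
        n ^ m * (∑[ l < g ] d ^ suc (toℕ l)) ∎
        where open ≤-Reasoning

      -- At most n d · d ordered pairs of distinct slots share a tail, and each of them collides
      -- with probability 1/n.
      mean-multiplicity : sumMaps m (λ f → sum (multiplicity f)) ≤ n ^ m * (d * d)
      mean-multiplicity = *-cancelˡ-≤ n (begin
        n * sumMaps m (λ f → sum (multiplicity f))
          ≡⟨ cong (n *_) (trans (sumMaps-sum m (λ s f → multiplicity f s))
              (sum-cong-≗ λ s → sumMaps-sum m (λ t f → χ (parallel? s t) * χ (f s Fin.≟ f t)))) ⟩
        n * (∑[ s < m ] ∑[ t < m ] E s t)
          ≡⟨ trans (*-distribˡ-sum n (λ s → ∑[ t < m ] E s t)) (sum-cong-≗ λ s → *-distribˡ-sum n (E s)) ⟩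
        (∑[ s < m ] ∑[ t < m ] n * E s t)
          ≤⟨ sum-mono (λ s → sum-mono (single s)) ⟩
        (∑[ s < m ] ∑[ t < m ] χ (τ t Fin.≟ τ s) * n ^ m)
          ≡⟨ sum-cong-≗ (λ s → trans (sym (*-distribʳ-sum (n ^ m) (λ t → χ (τ t Fin.≟ τ s))))
              (cong (_* n ^ m) (regular (τ s)))) ⟩
        (∑[ s < m ] d * n ^ m)
          ≡⟨ trans (sum-const m _) (cong (_* (d * n ^ m)) m≡n*d) ⟩
        n * d * (d * n ^ m)
          ≡⟨ rearrange n d (n ^ m) ⟩
        n * (n ^ m * (d * d)) ∎)
        where
        open ≤-Reasoning
        E : Fin m → Fin m → ℕ
        E s t = sumMaps m (λ f → χ (parallel? s t) * χ (f s Fin.≟ f t))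
        rearrange : ∀ n d x → n * d * (d * x) ≡ n * (x * (d * d))
        rearrange = solve-∀
        single : ∀ s t → n * E s t ≤ χ (τ t Fin.≟ τ s) * n ^ m
        single s t = sumMaps-χ-≤ m (parallel? s t) (λ f → χ (f s Fin.≟ f t)) {n} λ (s≢t , eq) →
          ≤-reflexive (trans (collision s t s≢t)
            (sym (trans (cong (_* n ^ m) (χ-yes (τ t Fin.≟ τ s) (sym eq))) (*-identityˡ _))))

      -- The sum of squares counts ordered pairs of slots with a common head: the n d diagonal pairs
      -- always qualify, any other pair with probability 1/n.
      mean-fiber² : sumMaps m (λ f → ∑[ v < n ] fiber f v * fiber f v) ≤ n ^ m * (d * n + d * d * n)
      mean-fiber² = *-cancelˡ-≤ n (begin
        n * sumMaps m (λ f → ∑[ v < n ] fiber f v * fiber f v)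
          ≡⟨ cong (n *_) (trans (sumMaps-cong m λ f → sym (sum-fibers f (fiber f)))
              (trans (sumMaps-sum m (λ s f → fiber f (f s)))
              (sum-cong-≗ λ s → sumMaps-sum m (λ t f → χ (f t Fin.≟ f s))))) ⟩
        n * (∑[ s < m ] ∑[ t < m ] E s t)
          ≡⟨ trans (*-distribˡ-sum n (λ s → ∑[ t < m ] E s t)) (sum-cong-≗ λ s → *-distribˡ-sum n (E s)) ⟩
        (∑[ s < m ] ∑[ t < m ] n * E s t)
          ≤⟨ sum-mono (λ s → sum-mono (single s)) ⟩
        (∑[ s < m ] ∑[ t < m ] χ (s Fin.≟ t) * (n * n ^ m) + n ^ m)
          ≡⟨ sum-cong-≗ (λ s → trans (∑-distrib-+ {m} (λ t → χ (s Fin.≟ t) * (n * n ^ m)) (λ _ → n ^ m))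
              (cong₂ _+_ (sum-δ s (λ _ → n * n ^ m)) (sum-const m _))) ⟩
        (∑[ s < m ] n * n ^ m + m * n ^ m)
          ≡⟨ trans (sum-const m _) (cong (λ x → x * (n * n ^ m + x * n ^ m)) m≡n*d) ⟩
        n * d * (n * n ^ m + n * d * n ^ m)
          ≡⟨ rearrange n d (n ^ m) ⟩
        n * (n ^ m * (d * n + d * d * n)) ∎)
        where
        open ≤-Reasoning
        E : Fin m → Fin m → ℕ
        E s t = sumMaps m (λ f → χ (f t Fin.≟ f s))
        rearrange : ∀ n d x → n * d * (n * x + n * d * x) ≡ n * (x * (d * n + d * d * n))
        rearrange = solve-∀
        single : ∀ s t → n * E s t ≤ χ (s Fin.≟ t) * (n * n ^ m) + n ^ m
        single s t with s Fin.≟ t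
        ... | yes refl = ≤-trans (≤-reflexive (cong (n *_)
            (trans (sumMaps-cong m λ f → χ-yes (f s Fin.≟ f s) refl)
            (trans (sumMaps-const m 1) (*-identityʳ _)))))
                                 (≤-trans (m≤m+n _ 0) (m≤m+n _ _))
        ... | no s≢t = ≤-reflexive (collision t s (s≢t ∘ sym))

      -- Expand the squares; the in-degrees sum to `m`, that is n d, so their mean is `d`.
      variance-identity : ∀ f → variance f + d * d * n ≡ ∑[ v < n ] fiber f v * fiber f v
      variance-identity f = +-cancelʳ-≡ (d * d * n) _ _ (begin
        variance f + d * d * n + d * d * n
          ≡⟨ trans (+-assoc (variance f) _ _) (cong (variance f +_)
              (trans (rearrange d n) (cong (2 * d *_) (sym m≡n*d)))) ⟩
        variance f + 2 * d * m
          ≡⟨ cong (variance f +_) (trans (cong (2 * d *_) (sym (sum-fiber f)))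
              (*-distribˡ-sum (2 * d) (fiber f))) ⟩
        variance f + (∑[ v < n ] 2 * d * fiber f v)
          ≡⟨ ∑-distrib-+ (λ v → ∣ fiber f v - d ∣ * ∣ fiber f v - d ∣) (λ v → 2 * d * fiber f v) ⟨
        ∑[ v < n ] ∣ fiber f v - d ∣ * ∣ fiber f v - d ∣ + 2 * d * fiber f v
          ≡⟨ sum-cong-≗ (λ v → dist-square (fiber f v) d) ⟩
        ∑[ v < n ] fiber f v * fiber f v + d * d
          ≡⟨ trans (∑-distrib-+ (λ v → fiber f v * fiber f v) (λ _ → d * d))
              (cong ((∑[ v < n ] fiber f v * fiber f v) +_) (trans (sum-const n _) (*-comm n _))) ⟩
        (∑[ v < n ] fiber f v * fiber f v) + d * d * n ∎)
        where
        open ≡-Reasoning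
        rearrange : ∀ d n → d * d * n + d * d * n ≡ 2 * d * (n * d)
        rearrange = solve-∀

      mean-variance : sumMaps m variance ≤ n ^ m * (d * n)
      mean-variance = +-cancelʳ-≤ (n ^ m * (d * d * n)) _ _ (begin
        sumMaps m variance + n ^ m * (d * d * n)
          ≡⟨ cong (sumMaps m variance +_) (sumMaps-const m (d * d * n)) ⟨
        sumMaps m variance + sumMaps {n} m (λ _ → d * d * n)
          ≡⟨ sumMaps-+ m variance (λ _ → d * d * n) ⟨
        sumMaps m (λ f → variance f + d * d * n)
          ≡⟨ sumMaps-cong m variance-identity ⟩
        sumMaps m (λ f → ∑[ v < n ] fiber f v * fiber f v)
          ≤⟨ mean-fiber² ⟩
        n ^ m * (d * n + d * d * n)
          ≡⟨ *-distribˡ-+ (n ^ m) (d * n) (d * d * n) ⟩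
        n ^ m * (d * n) + n ^ m * (d * d * n) ∎)
        where open ≤-Reasoning

    -- A Chebyshev argument: all `x` slots into a vertex of in-degree `x > M` are charged, and `W`
    -- times their number is covered by the share of that vertex in the variance.
    sum-crowding : ∀ {W M} → (∀ x → M < x → W * x ≤ ∣ x - d ∣ * ∣ x - d ∣) →
                   ∀ f → W * sum (crowding M f) ≤ variance f
    sum-crowding {W} {M} cost f = begin
      W * sum (crowding M f)
          ≡⟨ cong (W *_) (sum-fibers f (λ v → χ (M <? fiber f v))) ⟩
      W * (∑[ v < n ] fiber f v * χ (M <? fiber f v))
          ≡⟨ *-distribˡ-sum W (λ v → fiber f v * χ (M <? fiber f v)) ⟩
      (∑[ v < n ] W * (fiber f v * χ (M <? fiber f v)))        ≤⟨ sum-mono (λ v → single (fiber f v)) ⟩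
      variance f                                               ∎
      where
      open ≤-Reasoning
      single : ∀ x → W * (x * χ (M <? x)) ≤ ∣ x - d ∣ * ∣ x - d ∣
      single x = ≤-trans (≤-reflexive (sym (*-assoc W x _))) (*χ-≤ (M <? x) (cost x))

    module _ {k N : ℕ} (n≡k*N : n ≡ k * N) where

      -- By independence each slot contributes a factor that depends only on the label of its tail;
      -- each label is carried by `N` vertices with `d` slots each.
      mean-ascents : (c : Fin n → Fin k) → Balanced N c →
                     sumMaps m (λ f → 2 ^ ascents f c) ≡ ((N ^ d) ^ k * prod (upWeight k) ^ d) ^ N
      mean-ascents c bal = begin
        sumMaps m (λ f → 2 ^ ascents f c)
          ≡⟨ sumMaps-cong m (λ f → ^-sum 2 (λ s → χ (c (τ s) Fin.≤? c (f s)))) ⟩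
        sumMaps m (λ f → ∏[ s < m ] 2 ^ χ (c (τ s) Fin.≤? c (f s)))
          ≡⟨ sumMaps-prod m (λ s v → 2 ^ χ (c (τ s) Fin.≤? c v)) ⟩
        ∏[ s < m ] ∑[ v < n ] 2 ^ χ (c (τ s) Fin.≤? c v)
          ≡⟨ prod-cong (λ s → G≡ (c (τ s))) ⟩
        ∏[ s < m ] N * upWeight k (c (τ s))
          ≡⟨ prod-fibers τ (λ u → N * upWeight k (c u)) ⟩
        ∏[ u < n ] (N * upWeight k (c u)) ^ fiber τ u
          ≡⟨ prod-cong (λ u → cong ((N * upWeight k (c u)) ^_) (regular u)) ⟩
        ∏[ u < n ] (N * upWeight k (c u)) ^ d
          ≡⟨ prod-fibers c (λ i → (N * upWeight k i) ^ d) ⟩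
        ∏[ i < k ] ((N * upWeight k i) ^ d) ^ fiber c i
          ≡⟨ prod-cong (λ i → cong₂ _^_ (^-distribʳ-* N (upWeight k i) d) (bal i)) ⟩
        ∏[ i < k ] (N ^ d * upWeight k i ^ d) ^ N
          ≡⟨ ^-prod (λ i → N ^ d * upWeight k i ^ d) N ⟨
        (∏[ i < k ] N ^ d * upWeight k i ^ d) ^ N
          ≡⟨ cong (_^ N) (trans (∏-distrib-* (λ _ → N ^ d) (λ i → upWeight k i ^ d))
              (cong₂ _*_ (prod-const k (N ^ d)) (sym (^-prod (upWeight k) d)))) ⟩
        ((N ^ d) ^ k * prod (upWeight k) ^ d) ^ N ∎
        where
        open ≡-Reasoning
        G≡ : ∀ i → (∑[ v < n ] 2 ^ χ (i Fin.≤? c v)) ≡ N * upWeight k i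
        G≡ i = trans (sum-fibers c (λ j → 2 ^ χ (i Fin.≤? j)))
                     (trans (sum-cong-≗ {k} λ j → cong (_* 2 ^ χ (i Fin.≤? j)) (bal j))
                         (sym (*-distribˡ-sum {k} N (λ j → 2 ^ χ (i Fin.≤? j)))))

      -- Union bound over the `k ^ n` labellings. As n = k N, everything is an `N`-th power and the
      -- estimate reduces to one numerical inequality free of `N`. The leading 2 leaves room for a
      -- second event, the bound on the penalties.
      mean-labelWeight : ∀ T → .{{_ : NonZero N}} →
          2 * (k ^ k * prod (upWeight k) ^ d) < (k ^ d) ^ k * 2 ^ (T * k) →
                         2 * sumMaps m (λ f → sumMaps n (labelWeight {k} N f)) < n ^ m * 2 ^ (T * n)
      mean-labelWeight T {{N≢0}} small = begin-strict
        2 * sumMaps m (λ f → sumMaps n (labelWeight N f))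
          ≡⟨ cong (2 *_) (sumMaps-comm m n (labelWeight N)) ⟩
        2 * sumMaps n (λ c → sumMaps m (λ f → labelWeight N f c))
          ≤⟨ *-monoʳ-≤ 2 (sumMaps-mono n single) ⟩
        2 * sumMaps {k} n (λ _ → (A * X) ^ N)
          ≡⟨ cong (2 *_) (trans (sumMaps-const n ((A * X) ^ N)) (cong (λ n → k ^ n * (A * X) ^ N) n≡k*N)) ⟩
        2 * (k ^ (k * N) * (A * X) ^ N)
          ≡⟨ cong (λ x → 2 * (x * (A * X) ^ N)) (^-*-assoc k k N) ⟨
        2 * ((k ^ k) ^ N * (A * X) ^ N)
          ≡⟨ cong (λ x → 2 * ((k ^ k) ^ N * x)) (^-distribʳ-* A X N) ⟩
        2 * ((k ^ k) ^ N * (A ^ N * X ^ N))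
          ≡⟨ rearrange ((k ^ k) ^ N) (A ^ N) (X ^ N) ⟩
        A ^ N * (2 * ((k ^ k) ^ N * X ^ N))
          ≡⟨ cong (λ x → A ^ N * (2 * x)) (^-distribʳ-* (k ^ k) X N) ⟨
        A ^ N * (2 * (k ^ k * X) ^ N)
          <⟨ *-monoʳ-< (A ^ N) {{m^n≢0 A N {{m^n≢0 (N ^ d) k {{m^n≢0 N d}}}}}}
              (double-power (k ^ k * X) ((k ^ d) ^ k * 2 ^ (T * k)) N small) ⟩
        A ^ N * ((k ^ d) ^ k * 2 ^ (T * k)) ^ N
          ≡⟨ cong (A ^ N *_) (^-distribʳ-* ((k ^ d) ^ k) (2 ^ (T * k)) N) ⟩
        A ^ N * (((k ^ d) ^ k) ^ N * (2 ^ (T * k)) ^ N)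
          ≡⟨ *-assoc (A ^ N) _ _ ⟨
        A ^ N * ((k ^ d) ^ k) ^ N * (2 ^ (T * k)) ^ N
          ≡⟨ cong₂ _*_ (sym (^-distribʳ-* A ((k ^ d) ^ k) N))
              (trans (^-*-assoc 2 (T * k) N) (cong (2 ^_) (trans (*-assoc T k N) (cong (T *_) (sym n≡k*N)))))
              ⟩
        (A * (k ^ d) ^ k) ^ N * 2 ^ (T * n)
          ≡⟨ cong (_* 2 ^ (T * n)) total ⟩
        n ^ m * 2 ^ (T * n) ∎
        where
        open ≤-Reasoning
        A X : ℕ
        A = (N ^ d) ^ k
        X = prod (upWeight k) ^ d
        rearrange : ∀ a b c → 2 * (a * (b * c)) ≡ b * (2 * (a * c))
        rearrange = solve-∀
        -- For `N` = 0 this would say 2 < 1; for positive `N` the left side is at most (2 y)^N.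
        double-power : ∀ y z N .{{_ : NonZero N}} → 2 * y < z → 2 * y ^ N < z ^ N
        double-power y z (suc N) lt = ≤-<-trans
          (≤-trans (≤-reflexive (sym (*-assoc 2 y (y ^ N)))) (*-monoʳ-≤ (2 * y) (^-monoˡ-≤ N (m≤n*m y 2))))
          (^-monoˡ-< (suc N) lt)
        total : (A * (k ^ d) ^ k) ^ N ≡ n ^ m
        total = begin-equality
          ((N ^ d) ^ k * (k ^ d) ^ k) ^ N    ≡⟨ cong (_^ N)
              (trans (sym (^-distribʳ-* (N ^ d) (k ^ d) k)) (cong (_^ k) (sym (^-distribʳ-* N k d)))) ⟩
          (((N * k) ^ d) ^ k) ^ N            ≡⟨ trans (^-*-assoc ((N * k) ^ d) k N)
              (^-*-assoc (N * k) d (k * N)) ⟩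
          (N * k) ^ (d * (k * N))            ≡⟨ cong₂ _^_ (trans (*-comm N k) (sym n≡k*N))
              (trans (cong (d *_) (sym n≡k*N)) (trans (*-comm d n) (sym m≡n*d))) ⟩
          n ^ m                              ∎
        single : ∀ c → sumMaps m (λ f → labelWeight N f c) ≤ (A * X) ^ N
        single c = ≤-trans (≤-reflexive (sym (*-identityˡ _)))
            (sumMaps-χ-≤ m (balanced? N c) (λ f → 2 ^ ascents f c) {a = 1} λ bal →
          ≤-reflexive (trans (*-identityˡ _) (mean-ascents c bal)))

      -- One summand is at most the whole sum, so a small total weight controls all balanced
      -- labellings at once.
      ascents-bound : ∀ f b → sumMaps n (labelWeight {k} N f) < 2 ^ b → (c : Fin n → Fin k) → Balanced N c →
          ascents f c < b
      ascents-bound f b lt c bal = ≰⇒> λ b≤ → <-irrefl refl (begin-strict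
        2 ^ ascents f c                     ≡⟨ trans (cong (_* 2 ^ ascents f c) (χ-yes (balanced? N c) bal))
            (*-identityˡ _) ⟨
        labelWeight N f c                   ≤⟨ term≤sumMaps n (labelWeight N f) (λ eq → ≤-reflexive (ext eq))
            c ⟩
        sumMaps n (labelWeight {k} N f)     <⟨ lt ⟩
        2 ^ b                               ≤⟨ ^-monoʳ-≤ 2 b≤ ⟩
        2 ^ ascents f c                     ∎)
        where
        open ≤-Reasoning
        ext : ∀ {c c′ : Fin n → Fin k} → c ≗ c′ → labelWeight N f c ≡ labelWeight N f c′
        ext {c} {c′} eq = cong₂ _*_
          (χ-cong (balanced? N c) (balanced? N c′) (λ b j → trans (sym (fiber-cong eq j)) (b j))
              (λ b j → trans (fiber-cong eq j) (b j)))
          (cong (2 ^_) (sum-cong-≗ λ s → cong₂ (λ x y → χ (x Fin.≤? y)) (eq (τ s)) (eq (f s))))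

-- Markov's inequality for two events in one average: b Φ + 2a Ψ has mean below 2ab, and a value
-- below 2ab forces each of the two summands below it.
two-event-averaging : ∀ m (Φ Ψ : (Fin m → Fin n) → ℕ) a b .{{_ : NonZero a}} →
                      sumMaps m Φ ≤ n ^ m * a → 2 * sumMaps m Ψ < n ^ m * b →
                      ∃ λ f → Φ f < 2 * a × Ψ f < b
two-event-averaging {n} m Φ Ψ a b meanΦ meanΨ = f , left , right
  where
  open ≤-Reasoning
  average : sumMaps m (λ f → b * Φ f + 2 * a * Ψ f) < n ^ m * (2 * a * b)
  average = begin-strict
    sumMaps m (λ f → b * Φ f + 2 * a * Ψ f)
        ≡⟨ trans (sumMaps-+ m (λ f → b * Φ f) (λ f → 2 * a * Ψ f))
        (cong₂ _+_ (sumMaps-*ˡ m b Φ) (sumMaps-*ˡ m (2 * a) Ψ)) ⟩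
    b * sumMaps m Φ + 2 * a * sumMaps m Ψ
        ≡⟨ cong (b * sumMaps m Φ +_) (trans (cong (_* sumMaps m Ψ) (*-comm 2 a)) (*-assoc a 2 _)) ⟩
    b * sumMaps m Φ + a * (2 * sumMaps m Ψ)      <⟨ +-mono-≤-< (*-monoʳ-≤ b meanΦ) (*-monoʳ-< a meanΨ) ⟩
    b * (n ^ m * a) + a * (n ^ m * b)            ≡⟨ rearrange a b (n ^ m) ⟩
    n ^ m * (2 * a * b)                          ∎
    where
    rearrange : ∀ a b x → b * (x * a) + a * (x * b) ≡ x * (2 * a * b)
    rearrange = solve-∀
  found = averaging m (λ f → b * Φ f + 2 * a * Ψ f) (2 * a * b) average
  f = proj₁ found
  left : Φ f < 2 * a
  left = *-cancelˡ-< b _ _ (≤-<-trans (m≤m+n _ _) (<-≤-trans (proj₂ found) (≤-reflexive (*-comm (2 * a) b))))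
  right : Ψ f < b
  right = *-cancelˡ-< (2 * a) _ _ (≤-<-trans (m≤n+m _ _) (proj₂ found))

-- Linear extensions of acyclic relations

sum-split : ∀ k (F : Fin (k + l) → ℕ) → sum F ≡ (∑[ i < k ] F (i ↑ˡ l)) + (∑[ j < l ] F (k ↑ʳ j))
sum-split zero    F = refl
sum-split (suc k) F = trans (cong (F zero +_) (sum-split k (F ∘ suc))) (sym (+-assoc (F zero) _ _))

sum-combine : ∀ n d (F : Fin (n * d) → ℕ) → sum F ≡ (∑[ i < n ] ∑[ j < d ] F (combine i j))
sum-combine zero    d F = refl
sum-combine (suc n) d F = trans (sum-split d F)
    (cong ((∑[ j < d ] F (j ↑ˡ n * d)) +_) (sum-combine n d (F ∘ (d ↑ʳ_))))

fiber-quotient : ∀ n d (u : Fin n) → fiber (quotient {n} d) u ≡ d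
fiber-quotient n d u = begin
  fiber (quotient {n} d) u
    ≡⟨ sum-combine n d (λ s → χ (quotient {n} d s Fin.≟ u)) ⟩
  (∑[ i < n ] ∑[ j < d ] χ (quotient {n} d (combine i j) Fin.≟ u))
    ≡⟨ sum-cong-≗ (λ i → trans (sum-cong-≗ {d} λ j →
        trans (cong (λ p → χ (proj₁ p Fin.≟ u)) (Fin.remQuot-combine i j))
        (χ-cong (i Fin.≟ u) (u Fin.≟ i) sym sym))
                               (trans (sum-const d _) (*-comm d _))) ⟩
  (∑[ i < n ] χ (u Fin.≟ i) * d)
    ≡⟨ sum-δ u (λ _ → d) ⟩
  d ∎
  where open ≡-Reasoning

quotient-mono-≤ : ∀ {n} d {i j : Fin (n * d)} → i Fin.≤ j → quotient {n} d i Fin.≤ quotient {n} d j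
quotient-mono-≤ {n} d {i} {j} i≤j = ≮⇒≥ λ q → <⇒≱
  (subst₂ Fin._<_ (Fin.combine-remQuot {n} d j) (Fin.combine-remQuot {n} d i)
    (Fin.combine-monoˡ-< (proj₂ (remQuot {n} d j)) (proj₂ (remQuot {n} d i)) q)) i≤j

fiber-permute : (c : Fin m → Fin n) (π : Permutation l m) → ∀ j → fiber (c ∘ (π ⟨$⟩ʳ_)) j ≡ fiber c j
fiber-permute c π j = sym (∑-permute (λ u → χ (c u Fin.≟ j)) π)

-- A repetition at times `i < j` makes the point at time `i` periodic. The period j - i is written
-- as a successor to show that it is positive.
orbit-segment : ∀ {A : Set} (x : A) (h : A → A) {i j} → i < j → fold x h i ≡ fold x h j →
                fold (fold x h i) h (suc (j ∸ suc i)) ≡ fold x h i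
orbit-segment x h {i} {j} i<j eq = begin
  fold (fold x h i) h (suc (j ∸ suc i))   ≡⟨ fold-+ x h (suc (j ∸ suc i)) ⟨
  fold x h (suc (j ∸ suc i) + i)          ≡⟨ cong (fold x h) (trans (sym (+-suc (j ∸ suc i) i)) (m∸n+n≡m i<j))
      ⟩
  fold x h j                              ≡⟨ eq ⟨
  fold x h i                              ∎
  where open ≡-Reasoning

module _ {R : Fin n → Fin n → Set} (h : Fin n → Fin n) (step : ∀ u → R u (h u)) where

  -- A repetition inside the period yields a shorter period; b is fuel for this descent.
  periodic⇒cycle : ∀ b p x → p < b → fold x h (suc p) ≡ x → ∃ (DirCycle R)
  periodic⇒cycle (suc b) p x (s≤s p≤b) closed with Fin.any?
      (λ (i : Fin (suc p)) → Fin.any? λ j → (i Fin.<? j) ×-dec (fold x h (toℕ i) Fin.≟ fold x h (toℕ j)))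
  ... | yes (i , j , i<j , eq) = periodic⇒cycle b (toℕ j ∸ suc (toℕ i)) (fold x h (toℕ i))
        (≤-trans (∸-monoʳ-< {m = toℕ j} {n = suc (toℕ i)} {o = 0} z<s i<j)
            (≤-trans (≤-pred (Fin.toℕ<n j)) p≤b))
        (orbit-segment x h i<j eq)
  ... | no  distinct = suc p , (λ i → fold x h (toℕ i)) , inj ,
      (λ i → subst (λ t → R (fold x h t) (h (fold x h (toℕ i)))) (sym (Fin.toℕ-inject₁ i)) (step _)) ,
        subst₂ R (cong (fold x h) (sym (Fin.toℕ-fromℕ p))) closed (step _)
    where
    inj : Injective _≡_ _≡_ (λ (i : Fin (suc p)) → fold x h (toℕ i))
    inj {i} {j} eq with Fin.<-cmp i j
    ... | tri< i<j _ _ = contradiction (i , j , i<j , eq) distinct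
    ... | tri≈ _ i≡j _ = i≡j
    ... | tri> _ _ j<i = contradiction (j , i , j<i , sym eq) distinct

-- If every vertex had an out-neighbour, following chosen successors would repeat a vertex by
-- pigeonhole and so produce a directed cycle.
sink : {R : Fin (suc n) → Fin (suc n) → Set} → (∀ u v → Dec (R u v)) → Acyclic R → ∃ λ u → ∀ v → ¬ R u v
sink {n} {R} R? acyclic with Fin.any? (λ u → Fin.all? λ v → ¬? (R? u v))
... | yes s = s
... | no ∄sink = contradiction (proj₂ cycle) (acyclic (proj₁ cycle))
  where
  successor : ∀ u → ∃ λ v → R u v
  successor u with Fin.any? (R? u)
  ... | yes s = s
  ... | no ∄v = contradiction (u , λ v r → ∄v (v , r)) ∄sink
  h = proj₁ ∘ successor
  repeat = Fin.pigeonhole (n<1+n (suc n)) (λ i → fold zero h (toℕ i))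
  cycle : ∃ (DirCycle R)
  cycle with repeat
  ... | i , j , i<j , eq = periodic⇒cycle h (proj₂ ∘ successor) _ (toℕ j ∸ suc (toℕ i)) (fold zero h (toℕ i))
      ≤-refl
        (orbit-segment zero h i<j eq)

mapCycle : ∀ {a b} {R : Fin a → Fin a → Set} {S : Fin b → Fin b → Set} (φ : Fin a → Fin b) →
           Injective _≡_ _≡_ φ → (∀ {u v} → R u v → S (φ u) (φ v)) → ∀ k → DirCycle R k → DirCycle S k
mapCycle φ inj hom (suc k) (f , f-inj , steps , close) = φ ∘ f , f-inj ∘ inj , hom ∘ steps , hom close

punchIn-top-mono : {i j : Fin n} → i Fin.≤ j → punchIn (fromℕ n) i Fin.≤ punchIn (fromℕ n) j
punchIn-top-mono {i = zero}  {j}     _   = z≤n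
punchIn-top-mono {i = suc _} {suc _} i≤j = s≤s (punchIn-top-mono (s≤s⁻¹ i≤j))

insert-at : (w : Fin (suc m)) (j : Fin (suc n)) (π : Permutation m n) → insert w j π ⟨$⟩ʳ w ≡ j
insert-at w j π with w Fin.≟ w
... | yes _  = refl
... | no w≢w = contradiction refl w≢w

punchIn-cover : (w u : Fin (suc n)) → u ≡ w ⊎ ∃ λ u′ → u ≡ punchIn w u′
punchIn-cover w u with w Fin.≟ u
... | yes w≡u = inj₁ (sym w≡u)
... | no w≢u  = inj₂ (punchOut w≢u , sym (Fin.punchIn-punchOut w≢u))

-- Induction on `n`: a sink is placed last, and the remaining vertices are ordered recursively.
linearExtension : ∀ n (R : Fin n → Fin n → Set) → (∀ u v → Dec (R u v)) → Acyclic R →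
                  ∃ λ (π : Permutation′ n) → ∀ {u v} → R u v → (π ⟨$⟩ʳ u) Fin.≤ (π ⟨$⟩ʳ v)
linearExtension zero    R R? acyclic = idₚ , λ { {()} }
linearExtension (suc n) R R? acyclic = extend (sink R? acyclic)
  where
  extend : (∃ λ w → ∀ v → ¬ R w v) → ∃ λ (π : Permutation′ (suc n)) → ∀ {u v} → R u v →
      (π ⟨$⟩ʳ u) Fin.≤ (π ⟨$⟩ʳ v)
  extend (w , isSink) with linearExtension n (λ u v → R (punchIn w u) (punchIn w v))
      (λ u v → R? (punchIn w u) (punchIn w v))
                             (λ k → acyclic k ∘ mapCycle (punchIn w) (Fin.punchIn-injective w _ _) id k)
  ... | π , π-mono = π⁺ , λ {u} {v} r → mono r (punchIn-cover w u) (punchIn-cover w v)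
    where
    π⁺ = insert w (fromℕ n) π
    mono : ∀ {u v} → R u v → u ≡ w ⊎ (∃ λ u′ → u ≡ punchIn w u′) → v ≡ w ⊎ (∃ λ v′ → v ≡ punchIn w v′) →
        (π⁺ ⟨$⟩ʳ u) Fin.≤ (π⁺ ⟨$⟩ʳ v)
    mono r (inj₁ refl)        _                  = contradiction r (isSink _)
    mono r (inj₂ _)           (inj₁ refl)        =
        Fin.≤-trans (Fin.≤fromℕ _) (Fin.≤-reflexive (sym (insert-at w (fromℕ n) π)))
    mono r (inj₂ (u′ , refl)) (inj₂ (v′ , refl)) =
      subst₂ Fin._≤_ (sym (insert-punchIn w (fromℕ n) π u′)) (sym (insert-punchIn w (fromℕ n) π v′))
          (punchIn-top-mono (π-mono r))

-- The digraph of undeleted slots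

T-does : (p? : Dec P) → T (does p?) → P
T-does (yes p) _ = p

does-T : (p? : Dec P) → P → T (does p?)
does-T (yes _) _ = _
does-T (no ¬p) p = ¬p p

list-sum : (g : Fin k → ℕ) → List.sum (map g (allFin k)) ≡ sum g
list-sum g = trans (cong List.sum (map-tabulate id g)) (sum-tabulate g)
  where
  sum-tabulate : ∀ {k} (g : Fin k → ℕ) → List.sum (tabulate g) ≡ sum g
  sum-tabulate {zero}  g = refl
  sum-tabulate {suc k} g = cong (g zero +_) (sum-tabulate (g ∘ suc))

count≡sum : (p : Fin k → Bool) → count p ≡ (∑[ i < k ] χ (T? (p i)))
count≡sum p = list-sum λ i → χ (T? (p i))

size≡sum : ∀ D (F : ArcSubset D) → size D F ≡ (∑[ u < order D ] ∑[ v < order D ] χ (T? (F u v)))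
size≡sum D F = trans (list-sum λ u → count (F u)) (sum-cong-≗ λ u → count≡sum (F u))

χ≤1 : (p? : Dec P) → χ p? ≤ 1
χ≤1 (yes _) = ≤-refl
χ≤1 (no _)  = z≤n

χ-any-≤ : {P : Fin m → Set} (d : Dec (∃ P)) (P? : ∀ s → Dec (P s)) → χ d ≤ (∑[ s < m ] χ (P? s))
χ-any-≤ (yes (s , p)) P? = ≤-trans (≤-reflexive (sym (χ-yes (P? s) p))) (term≤sum (λ s → χ (P? s)) s)
χ-any-≤ (no _)        P? = z≤n

χ-unique-≤ : {P : Fin m → Set} (d : Dec (∃ P)) (P? : ∀ s → Dec (P s)) → (∀ s t → P s → P t → s ≡ t) →
             (∑[ s < m ] χ (P? s)) ≤ χ d
χ-unique-≤ {m} (yes (s₀ , p₀)) P? unique = begin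
  (∑[ s < m ] χ (P? s))              ≤⟨ sum-mono (λ s → χ-mono (P? s) (s₀ Fin.≟ s) (unique s₀ s p₀)) ⟩
  (∑[ s < m ] χ (s₀ Fin.≟ s))        ≡⟨ sum-cong-≗ (λ s → *-identityʳ (χ (s₀ Fin.≟ s))) ⟨
  (∑[ s < m ] χ (s₀ Fin.≟ s) * 1)    ≡⟨ sum-δ s₀ (λ _ → 1) ⟩
  1                                  ∎
  where open ≤-Reasoning
χ-unique-≤ {m} (no ∄) P? unique = ≤-reflexive (trans (sum-cong-≗ λ s → χ-no (P? s) λ p → ∄ (s , p))
    (trans (sum-const m 0) (*-zeroʳ m)))

cycle-step : {R : Fin n → Fin n → Set} (f : Fin (suc l) → Fin n) → (∀ i → R (f (inject₁ i)) (f (suc i))) →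
             R (f (fromℕ l)) (f zero) → ∀ t → R (f t) (f (next t))
cycle-step f steps close t with view t
... | ‵fromℕ     = close
... | ‵inject₁ i = steps i

-- A loop is a directed cycle of length 1, and two opposite arcs form one of length 2.
girth≥3⇒oriented : ∀ D {g} → 3 ≤ g → GirthAtLeast D g → Oriented D
girth≥3⇒oriented D {g} 3≤g girth = noLoop , no2Cycle
  where
  noLoop : ∀ u → ¬ Arc D u u
  noLoop u a = contradiction (≤-trans 3≤g (girth 1 ((λ _ → u) , (λ { {zero} {zero} _ → refl }) , (λ ()) , a)))
      λ { (s≤s ()) }
  no2Cycle : ∀ u v → Arc D u v → ¬ Arc D v u
  no2Cycle u v a a′ = contradiction (≤-trans 3≤g (girth 2 (u ∷ v ∷ [] , inj , (λ { zero → a }) , a′)))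
      λ { (s≤s (s≤s ())) }
    where
    u≢v : u ≢ v
    u≢v refl = noLoop u a
    inj : Injective _≡_ _≡_ (u ∷ v ∷ [])
    inj {zero}     {zero}     _  = refl
    inj {zero}     {suc zero} eq = contradiction eq u≢v
    inj {suc zero} {zero}     eq = contradiction (sym eq) u≢v
    inj {suc zero} {suc zero} _  = refl

-- Any weight `b` may govern the deletions: exactly the slots with `b s ≡ 0` survive. The penalty is
-- substituted for it later.
module Thinning {m n : ℕ} (τ f : Fin m → Fin n) (b : Fin m → ℕ) where

  open Slots τ

  joins? : ∀ u v s → Dec (τ s ≡ u × f s ≡ v × b s ≡ 0)
  joins? u v s = (τ s Fin.≟ u) ×-dec ((f s Fin.≟ v) ×-dec (b s ≟ 0))

  joined? : ∀ u v → Dec (∃ λ s → τ s ≡ u × f s ≡ v × b s ≡ 0)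
  joined? u v = Fin.any? (joins? u v)

  thinned : Digraph
  thinned = record { n = n ; adj = λ u v → does (joined? u v) }

  numArcs≡ : numArcs thinned ≡ (∑[ u < n ] ∑[ v < n ] χ (joined? u v))
  numArcs≡ = size≡sum thinned (adj thinned)

  χ-joins : ∀ u v s → χ (joins? u v s) ≡ χ (τ s Fin.≟ u) * (χ (f s Fin.≟ v) * χ (b s ≟ 0))
  χ-joins u v s = trans (χ-× (τ s Fin.≟ u) ((f s Fin.≟ v) ×-dec (b s ≟ 0)))
      (cong (χ (τ s Fin.≟ u) *_) (χ-× (f s Fin.≟ v) (b s ≟ 0)))

  -- Each slot has exactly one pair of ends. This converts sums over pairs of vertices into sums
  -- over slots.
  sum-over-ends : (w : Fin m → ℕ) → (∑[ u < n ] ∑[ v < n ] ∑[ s < m ] χ (τ s Fin.≟ u)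
      * (χ (f s Fin.≟ v) * w s)) ≡ sum w
  sum-over-ends w = begin
    (∑[ u < n ] ∑[ v < n ] ∑[ s < m ] χ (τ s Fin.≟ u) * (χ (f s Fin.≟ v) * w s))
      ≡⟨ sum-cong-≗ (λ u → ∑-comm (λ v s → χ (τ s Fin.≟ u) * (χ (f s Fin.≟ v) * w s))) ⟩
    (∑[ u < n ] ∑[ s < m ] ∑[ v < n ] χ (τ s Fin.≟ u) * (χ (f s Fin.≟ v) * w s))
      ≡⟨ ∑-comm (λ u s → ∑[ v < n ] χ (τ s Fin.≟ u) * (χ (f s Fin.≟ v) * w s)) ⟩
    (∑[ s < m ] ∑[ u < n ] ∑[ v < n ] χ (τ s Fin.≟ u) * (χ (f s Fin.≟ v) * w s))
      ≡⟨ sum-cong-≗ (λ s → sum-cong-≗ λ u → trans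
          (sym (*-distribˡ-sum (χ (τ s Fin.≟ u)) (λ v → χ (f s Fin.≟ v) * w s)))
          (cong (χ (τ s Fin.≟ u) *_) (sum-δ (f s) (λ _ → w s)))) ⟩
    (∑[ s < m ] ∑[ u < n ] χ (τ s Fin.≟ u) * w s)
      ≡⟨ sum-cong-≗ (λ s → sum-δ (τ s) (λ _ → w s)) ⟩
    sum w ∎
    where open ≡-Reasoning

  outdeg-≤ : ∀ u → outdeg thinned u ≤ fiber τ u
  outdeg-≤ u = begin
    outdeg thinned u
      ≡⟨ count≡sum (adj thinned u) ⟩
    (∑[ v < n ] χ (joined? u v))
      ≤⟨ sum-mono (λ v → ≤-trans (χ-any-≤ (joined? u v) (joins? u v)) (sum-mono λ s → ≤-trans
           (χ-mono (joins? u v s) ((f s Fin.≟ v) ×-dec (τ s Fin.≟ u)) (λ (τs , fs , _) → fs , τs))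
               (≤-reflexive (χ-× (f s Fin.≟ v) (τ s Fin.≟ u))))) ⟩
    (∑[ v < n ] ∑[ s < m ] χ (f s Fin.≟ v) * χ (τ s Fin.≟ u))
      ≡⟨ ∑-comm (λ v s → χ (f s Fin.≟ v) * χ (τ s Fin.≟ u)) ⟩
    (∑[ s < m ] ∑[ v < n ] χ (f s Fin.≟ v) * χ (τ s Fin.≟ u))
      ≡⟨ sum-cong-≗ (λ s → sum-δ (f s) (λ _ → χ (τ s Fin.≟ u))) ⟩
    fiber τ u ∎
    where open ≤-Reasoning

  indeg-≤-fiber : ∀ v → indeg thinned v ≤ fiber f v
  indeg-≤-fiber v = begin
    indeg thinned v
      ≡⟨ count≡sum (λ u → adj thinned u v) ⟩
    (∑[ u < n ] χ (joined? u v))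
      ≤⟨ sum-mono (λ u → ≤-trans (χ-any-≤ (joined? u v) (joins? u v)) (sum-mono λ s → ≤-trans
           (χ-mono (joins? u v s) ((τ s Fin.≟ u) ×-dec (f s Fin.≟ v)) (λ (τs , fs , _) → τs , fs))
               (≤-reflexive (χ-× (τ s Fin.≟ u) (f s Fin.≟ v))))) ⟩
    (∑[ u < n ] ∑[ s < m ] χ (τ s Fin.≟ u) * χ (f s Fin.≟ v))
      ≡⟨ ∑-comm (λ u s → χ (τ s Fin.≟ u) * χ (f s Fin.≟ v)) ⟩
    (∑[ s < m ] ∑[ u < n ] χ (τ s Fin.≟ u) * χ (f s Fin.≟ v))
      ≡⟨ sum-cong-≗ (λ s → sum-δ (τ s) (λ _ → χ (f s Fin.≟ v))) ⟩
    fiber f v ∎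
    where open ≤-Reasoning

  -- A vertex with more than `M` incoming slots loses all of them; every other vertex meets the
  -- bound before any deletion.
  indeg-≤ : ∀ M → (∀ s → M < fiber f (f s) → 0 < b s) → ∀ v → indeg thinned v ≤ M
  indeg-≤ M crowded v with ≤-<-connex (fiber f v) M
  ... | inj₁ few  = ≤-trans (indeg-≤-fiber v) few
  ... | inj₂ many = ≤-trans (≤-reflexive (trans (count≡sum (λ u → adj thinned u v))
                      (trans (sum-cong-≗ λ u → χ-no (joined? u v) (noArc u))
                          (trans (sum-const n 0) (*-zeroʳ n))))) z≤n
    where
    noArc : ∀ u → ¬ (∃ λ s → τ s ≡ u × f s ≡ v × b s ≡ 0)
    noArc u (s , _ , refl , bs) = <-irrefl (sym bs) (crowded s many)

  -- Surviving slots give pairwise different arcs, and each deleted slot is paid for by its own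
  -- positive `b s`.
  slots≤arcs+b : (∀ s t → s ≢ t → τ s ≡ τ t → f s ≡ f t → 0 < b s) → m ≤ numArcs thinned + sum b
  slots≤arcs+b noParallel = begin
    m
      ≡⟨ trans (sum-const m 1) (*-identityʳ m) ⟨
    (∑[ s < m ] 1)
      ≤⟨ sum-mono (λ s → good-or-bad (b s)) ⟩
    (∑[ s < m ] χ (b s ≟ 0) + b s)
      ≡⟨ ∑-distrib-+ (λ s → χ (b s ≟ 0)) b ⟩
    (∑[ s < m ] χ (b s ≟ 0)) + sum b
      ≡⟨ cong (_+ sum b) (sum-over-ends (λ s → χ (b s ≟ 0))) ⟨
    (∑[ u < n ] ∑[ v < n ] ∑[ s < m ] χ (τ s Fin.≟ u) * (χ (f s Fin.≟ v) * χ (b s ≟ 0))) + sum b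
      ≡⟨ cong (_+ sum b) (sum-cong-≗ λ u → sum-cong-≗ λ v → sum-cong-≗ λ s → χ-joins u v s) ⟨
    (∑[ u < n ] ∑[ v < n ] ∑[ s < m ] χ (joins? u v s)) + sum b
      ≤⟨ +-monoˡ-≤ (sum b) (sum-mono λ u → sum-mono λ v → χ-unique-≤ (joined? u v) (joins? u v) unique) ⟩
    (∑[ u < n ] ∑[ v < n ] χ (joined? u v)) + sum b
      ≡⟨ cong (_+ sum b) numArcs≡ ⟨
    numArcs thinned + sum b ∎
    where
    open ≤-Reasoning
    good-or-bad : ∀ x → 1 ≤ χ (x ≟ 0) + x
    good-or-bad zero    = ≤-refl
    good-or-bad (suc x) = s≤s z≤n
    unique : ∀ {u v} s t → τ s ≡ u × f s ≡ v × b s ≡ 0 → τ t ≡ u × f t ≡ v × b t ≡ 0 → s ≡ t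
    unique s t (τs , fs , bs) (τt , ft , _) with s Fin.≟ t
    ... | yes s≡t = s≡t
    ... | no s≢t  = contradiction (noParallel s t s≢t (trans τs (sym τt)) (trans fs (sym ft)))
        (<-irrefl (sym bs))

  -- An arc outside `F` does not descend, so a slot realising it is counted by `ascents`.
  monotone⇒arcs≤ : (F : ArcSubset thinned) (c : Fin n → Fin k) →
                   (∀ u v → Arc thinned u v × ¬ T (F u v) → c u Fin.≤ c v) →
                       numArcs thinned ≤ size thinned F + ascents f c
  monotone⇒arcs≤ F c mono = begin
    numArcs thinned
      ≡⟨ numArcs≡ ⟩
    (∑[ u < n ] ∑[ v < n ] χ (joined? u v))
      ≤⟨ sum-mono (λ u → sum-mono λ v → single u v) ⟩
    (∑[ u < n ] ∑[ v < n ] χ (T? (F u v)) + (∑[ s < m ] asc u v s))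
      ≡⟨ trans (sum-cong-≗ λ u → ∑-distrib-+ (λ v → χ (T? (F u v))) (λ v → ∑[ s < m ] asc u v s))
          (∑-distrib-+ (λ u → ∑[ v < n ] χ (T? (F u v))) (λ u → ∑[ v < n ] ∑[ s < m ] asc u v s)) ⟩
    (∑[ u < n ] ∑[ v < n ] χ (T? (F u v))) + (∑[ u < n ] ∑[ v < n ] ∑[ s < m ] asc u v s)
      ≡⟨ cong₂ _+_ (sym (size≡sum thinned F)) (sum-over-ends (λ s → χ (c (τ s) Fin.≤? c (f s)))) ⟩
    size thinned F + ascents f c ∎
    where
    open ≤-Reasoning
    asc : Fin n → Fin n → Fin m → ℕ
    asc u v s = χ (τ s Fin.≟ u) * (χ (f s Fin.≟ v) * χ (c (τ s) Fin.≤? c (f s)))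
    asc? : ∀ u v s → Dec (τ s ≡ u × f s ≡ v × c (τ s) Fin.≤ c (f s))
    asc? u v s = (τ s Fin.≟ u) ×-dec ((f s Fin.≟ v) ×-dec (c (τ s) Fin.≤? c (f s)))
    single : ∀ u v → χ (joined? u v) ≤ χ (T? (F u v)) + (∑[ s < m ] asc u v s)
    single u v = caseInF (T? (F u v))
      where
      caseInF : (inF? : Dec (T (F u v))) → χ (joined? u v) ≤ χ inF? + (∑[ s < m ] asc u v s)
      caseInF (yes _)  = ≤-trans (χ≤1 (joined? u v)) (m≤m+n 1 _)
      caseInF (no ∉F) = ≤-trans (χ-any-≤ (joined? u v) (joins? u v)) (sum-mono λ s → ≤-trans
        (χ-mono (joins? u v s) (asc? u v s) λ { j@(refl , refl , _) → refl , refl ,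
            mono _ _ (does-T (joined? u v) (s , j) , ∉F) })
        (≤-reflexive (trans (χ-× (τ s Fin.≟ u) ((f s Fin.≟ v) ×-dec (c (τ s) Fin.≤? c (f s))))
          (cong (χ (τ s Fin.≟ u) *_) (χ-× (f s Fin.≟ v) (c (τ s) Fin.≤? c (f s)))))))

  -- The slots realising the arcs of a cycle are distinct because their tails are. On a short cycle
  -- the first of them would have positive weight, although it survived.
  girth-≥ : ∀ g → (∀ l (s : Fin (suc l) → Fin m) → l < g → Injective _≡_ _≡_ s →
      (∀ t → f (s t) ≡ τ (s (next t))) → 0 < b (s zero)) →
            GirthAtLeast thinned g
  girth-≥ g short (suc l) (w , w-inj , steps , close) = ≮⇒≥ λ l<g →
    <-irrefl (sym (proj₂ (proj₂ (proj₂ (slot zero))))) (short l (proj₁ ∘ slot) (<-trans (n<1+n l) l<g) inj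
      (λ t → trans (proj₁ (proj₂ (proj₂ (slot t)))) (sym (proj₁ (proj₂ (slot (next t)))))))
    where
    slot : ∀ t → ∃ λ s → τ s ≡ w t × f s ≡ w (next t) × b s ≡ 0
    slot t = T-does (joined? (w t) (w (next t))) (cycle-step {R = Arc thinned} w steps close t)
    inj : Injective _≡_ _≡_ (proj₁ ∘ slot)
    inj {i} {j} eq = w-inj (trans (sym (proj₁ (proj₂ (slot i)))) (trans (cong τ eq) (proj₁ (proj₂ (slot j)))))

  -- Cutting a linear extension of the arcs outside `F` into `k` blocks of size `N` gives a balanced
  -- labelling along which none of these arcs descends.
  fas-bound : ∀ {k N} (n≡k*N : n ≡ k * N) a → (∀ (c : Fin n → Fin k) → Balanced N c → ascents f c < a) →
              ∀ F → IsFAS thinned F → numArcs thinned < size thinned F + a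
  fas-bound {k} {N} refl a bound F (_ , acyclic) =
    ≤-<-trans (monotone⇒arcs≤ F c (λ u v r → quotient-mono-≤ {k} N (proj₂ order-of r)))
      (+-monoʳ-< (size thinned F) (bound c λ j →
          trans (fiber-permute (quotient {k} N) (proj₁ order-of) j) (fiber-quotient k N j)))
    where
    order-of = linearExtension n (λ u v → Arc thinned u v × ¬ T (F u v))
        (λ u v → T? (adj thinned u v) ×-dec ¬? (T? (F u v))) acyclic
    c : Fin n → Fin k
    c u = quotient {k} N (proj₁ order-of ⟨$⟩ʳ u)

-- Penalties of unwanted slots

module Penalties {m n : ℕ} (τ f : Fin m → Fin n) where

  open Slots τ

  slotCycle-positive : (s : Fin (suc l) → Fin m) → Injective _≡_ _≡_ s → (∀ t → f (s t) ≡ τ (s (next t))) →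
      slotCycle f s ≡ 1
  slotCycle-positive {l} s inj closed = cong₂ _*_ (χ-yes (injective? s) (λ _ _ → inj))
    (trans (prod-cong λ t → χ-yes (f (s t) Fin.≟ τ (s (next t))) (closed t))
        (trans (prod-const (suc l) 1) (^-zeroˡ (suc l))))

  slotCycle-cong : {s s′ : Fin (suc l) → Fin m} → s ≗ s′ → slotCycle f s ≡ slotCycle f s′
  slotCycle-cong {s = s} {s′} eq = cong₂ _*_
    (χ-cong (injective? s) (injective? s′) (λ inj i j e → inj i j (trans (eq i) (trans e (sym (eq j)))))
                                           (λ inj i j e → inj i j (trans (sym (eq i)) (trans e (eq j)))))
    (prod-cong λ t → cong₂ (λ r r′ → χ (f r Fin.≟ τ r′)) (eq t) (eq (next t)))

  short-penalised : ∀ {g} M (s : Fin (suc l) → Fin m) → l < g → Injective _≡_ _≡_ s →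
      (∀ t → f (s t) ≡ τ (s (next t))) →
                       0 < penalty g M f (s zero)
  short-penalised {l} {g} M s l<g inj closed = begin
    1
      ≡⟨ cong₂ _*_ (χ-yes (s zero Fin.≟ s zero) refl) (slotCycle-positive s inj closed) ⟨
    χ (s zero Fin.≟ s zero) * slotCycle f s
      ≤⟨ term≤sumMaps (suc l) (λ s′ → χ (s′ zero Fin.≟ s zero) * slotCycle f s′)
           (λ eq → ≤-reflexive (cong₂ _*_ (cong (λ r → χ (r Fin.≟ s zero)) (eq zero)) (slotCycle-cong eq))) s
               ⟩
    slotCyclesAt l f (s zero)
      ≡⟨ cong (λ l → slotCyclesAt l f (s zero)) (Fin.toℕ-fromℕ< l<g) ⟨
    slotCyclesAt (toℕ (Fin.fromℕ< l<g)) f (s zero)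
      ≤⟨ term≤sum (λ l → slotCyclesAt (toℕ l) f (s zero)) (Fin.fromℕ< l<g) ⟩
    shortness g f (s zero)
      ≤⟨ ≤-trans (m≤m+n _ (multiplicity f (s zero))) (m≤m+n _ (crowding M f (s zero))) ⟩
    penalty g M f (s zero) ∎
    where open ≤-Reasoning

  parallel-penalised : ∀ g M s t → s ≢ t → τ s ≡ τ t → f s ≡ f t → 0 < penalty g M f s
  parallel-penalised g M s t s≢t τeq feq = begin
    1                                         ≡⟨ cong₂ _*_ (χ-yes (parallel? s t) (s≢t , τeq))
        (χ-yes (f s Fin.≟ f t) feq) ⟨
    χ (parallel? s t) * χ (f s Fin.≟ f t)     ≤⟨ term≤sum (λ t → χ (parallel? s t) * χ (f s Fin.≟ f t)) t ⟩
    multiplicity f s                          ≤⟨ ≤-trans (m≤n+m _ (shortness g f s))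
        (m≤m+n _ (crowding M f s)) ⟩
    penalty g M f s                           ∎
    where open ≤-Reasoning

  crowd-penalised : ∀ g M s → M < fiber f (f s) → 0 < penalty g M f s
  crowd-penalised g M s many = ≤-trans (≤-reflexive (sym (χ-yes (M <? fiber f (f s)) many)))
      (m≤n+m _ (shortness g f s + multiplicity f s))

-- Heads with few deletions and few ascents

module _ {m n d : ℕ} (τ : Fin m → Fin n) (regular : ∀ u → fiber τ u ≡ d) .{{_ : NonZero n}} where

  private
    W M : ℕ
    -- The scaled penalty has mean at most (d + 1) n in `goodHeads`; the factor 2 lost to Markov
    -- turns this into `W * n`.
    W = 2 * suc d
    M = d + 2 * W

  open Slots τ
  open Regular regular

  -- With e = x - d, the threshold gives e ≥ 2W ≥ d, hence W (d + e) ≤ 2 W e ≤ e².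
  crowded-cost : ∀ x → M < x → W * x ≤ ∣ x - d ∣ * ∣ x - d ∣
  crowded-cost x M<x = subst (λ x → W * x ≤ ∣ x - d ∣ * ∣ x - d ∣) (m+[n∸m]≡n d≤x) (begin
    W * (d + e)                         ≤⟨ *-monoʳ-≤ W (+-monoˡ-≤ e d≤e) ⟩
    W * (e + e)                         ≡⟨ rearrange W e ⟩
    2 * W * e                           ≤⟨ *-monoˡ-≤ e 2W≤e ⟩
    e * e                               ≡⟨ cong₂ _*_ dist dist ⟨
    ∣ d + e - d ∣ * ∣ d + e - d ∣       ∎)
    where
    open ≤-Reasoning
    e = x ∸ d
    d≤x : d ≤ x
    d≤x = ≤-trans (m≤m+n d (2 * W)) (<⇒≤ M<x)
    2W≤e : 2 * W ≤ e
    2W≤e = ≤-trans (≤-reflexive (sym (m+n∸m≡n d (2 * W)))) (∸-monoˡ-≤ d (<⇒≤ M<x))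
    d≤e : d ≤ e
    d≤e = ≤-trans (≤-trans (n≤1+n d) (≤-trans (m≤n*m (suc d) 2) (m≤n*m W 2))) 2W≤e
    dist : ∣ d + e - d ∣ ≡ e
    dist = trans (cong (∣ d + e -_∣) (sym (+-identityʳ d))) (trans (∣m+n-m+o∣≡∣n-o∣ d e 0) (∣-∣-identityʳ e))
    rearrange : ∀ W e → W * (e + e) ≡ 2 * W * e
    rearrange = solve-∀

  sum-penalty : ∀ g f → W * sum (penalty g M f) ≤ W * (sum (shortness g f) + sum (multiplicity f)) + variance
      f
  sum-penalty g f = begin
    W * sum (penalty g M f)
      ≡⟨ cong (W *_) (trans (∑-distrib-+ (λ s → shortness g f s + multiplicity f s) (crowding M f))
                            (cong (_+ sum (crowding M f)) (∑-distrib-+ (shortness g f) (multiplicity f)))) ⟩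
    W * (sum (shortness g f) + sum (multiplicity f) + sum (crowding M f))
      ≡⟨ *-distribˡ-+ W _ (sum (crowding M f)) ⟩
    W * (sum (shortness g f) + sum (multiplicity f)) + W * sum (crowding M f)
      ≤⟨ +-monoʳ-≤ _ (sum-crowding {W} {M} crowded-cost f) ⟩
    W * (sum (shortness g f) + sum (multiplicity f)) + variance f ∎
    where open ≤-Reasoning

  -- After scaling by `W`, short cycles and parallel slots cost at most `n` in the mean by the size
  -- condition on `n`, and the variance at most d n. Some `f` stays below twice this total, which is
  -- W n, while its label weights stay below 2^(T n).
  goodHeads : ∀ g {k N} T → n ≡ k * N → .{{NonZero N}} →
              W * ((∑[ l < g ] d ^ suc (toℕ l)) + d * d) ≤ n →
              2 * (k ^ k * prod (upWeight k) ^ d) < (k ^ d) ^ k * 2 ^ (T * k) →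
              ∃ λ f → sum (penalty g M f) < n × (∀ (c : Fin n → Fin k) → Balanced N c → ascents f c < T * n)
  goodHeads g {k} {N} T n≡k*N large small = f , few , ascents-bound n≡k*N f (T * n) (proj₂ (proj₂ found))
    where
    open ≤-Reasoning
    K = ∑[ l < g ] d ^ suc (toℕ l)
    Φ : (Fin m → Fin n) → ℕ
    Φ f = W * (sum (shortness g f) + sum (multiplicity f)) + variance f
    mean-Φ : sumMaps m Φ ≤ n ^ m * (suc d * n)
    mean-Φ = begin
      sumMaps m Φ
        ≡⟨ trans (sumMaps-+ m (λ f → W * (sum (shortness g f) + sum (multiplicity f))) variance)
             (cong (_+ sumMaps m variance) (trans
                 (sumMaps-*ˡ m W (λ f → sum (shortness g f) + sum (multiplicity f)))
               (cong (W *_) (sumMaps-+ m (λ f → sum (shortness g f)) (λ f → sum (multiplicity f)))))) ⟩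
      W * (sumMaps m (λ f → sum (shortness g f)) + sumMaps m (λ f → sum (multiplicity f))) + sumMaps m
          variance
        ≤⟨ +-mono-≤ (*-monoʳ-≤ W (+-mono-≤ (mean-shortness g) mean-multiplicity)) mean-variance ⟩
      W * (n ^ m * K + n ^ m * (d * d)) + n ^ m * (d * n)
        ≡⟨ rearrange W (n ^ m) K (d * d) (d * n) ⟩
      n ^ m * (W * (K + d * d) + d * n)
        ≤⟨ *-monoʳ-≤ (n ^ m) (+-monoˡ-≤ (d * n) large) ⟩
      n ^ m * (suc d * n) ∎
      where
      rearrange : ∀ W x K e v → W * (x * K + x * e) + x * v ≡ x * (W * (K + e) + v)
      rearrange = solve-∀
    found = two-event-averaging m Φ (λ f → sumMaps n (labelWeight {k} N f)) (suc d * n) (2 ^ (T * n))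
        {{m*n≢0 (suc d) n}}
              mean-Φ (mean-labelWeight n≡k*N T small)
    f = proj₁ found
    few : sum (penalty g M f) < n
    few = *-cancelˡ-< W _ _ (≤-<-trans (sum-penalty g f)
        (<-≤-trans (proj₁ (proj₂ found)) (≤-reflexive (sym (*-assoc 2 (suc d) n)))))

-- Robust digraphs and pendant arcs

-- slack counts the arcs that may still be added without spoiling fas > a/3.
record Robust (g Δ slack : ℕ) (D : Digraph) : Set where
  field
    girth   : GirthAtLeast D g
    degrees : MaxDegreeLe D Δ
    heavy   : ∀ F → IsFAS D F → numArcs D + slack < 3 * size D F

open Robust

-- At least (d - 1) V arcs survive, and at most |F| + T V of them exist for any feedback arc set F.
-- So 3 |F| > a + Δ follows from 2 (d - 1) V ≥ 3 T V + Δ, which the first hypothesis gives since Δ ≤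
-- 2 V; it is an equality for d = 128 and T = 84. The second hypothesis adds the out-degree `d` to
-- the cap on in-degrees.
robustDigraph : ∀ g Δ d k T .{{_ : NonZero k}} → 3 * T + 4 ≤ 2 * d → d + (d + 2 * (2 * suc d)) ≤ Δ →
                2 * (k ^ k * prod (upWeight k) ^ d) < (k ^ d) ^ k * 2 ^ (T * k) →
                ∃ λ D → Robust g Δ Δ D × Fin (order D)
robustDigraph g Δ d k T few-ascents degree-bound small = thinned , robust , Fin.fromℕ< V>0
  where
  open ≤-Reasoning
  K = ∑[ l < g ] d ^ suc (toℕ l)
  M = d + 2 * (2 * suc d)
  -- Large enough for the size condition of `goodHeads` and for the slack `Δ` to be at most 2 V;
  -- `suc` keeps it positive.
  N = suc (2 * suc d * (K + d * d) + Δ)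
  V = k * N
  N≤V : N ≤ V
  N≤V = m≤n*m N k
  V>0 : 0 < V
  V>0 = ≤-trans z<s N≤V
  instance
    V≢0 : NonZero V
    V≢0 = >-nonZero V>0
  τ : Fin (V * d) → Fin V
  τ = quotient d
  found = goodHeads τ (fiber-quotient V d) g {k} {N} T refl
            (≤-trans (≤-trans (m≤m+n _ Δ) (n≤1+n _)) N≤V) small
  f = proj₁ found
  b = Slots.penalty τ g M f
  open Thinning τ f b
  open Penalties τ f
  many : V * d ≤ numArcs thinned + V
  many = ≤-trans (slots≤arcs+b (parallel-penalised g M))
      (+-monoʳ-≤ (numArcs thinned) (<⇒≤ (proj₁ (proj₂ found))))
  robust : Robust g Δ Δ thinned
  robust .girth = girth-≥ g λ l s → short-penalised M s
  robust .degrees u = ≤-trans (+-mono-≤ (≤-trans (outdeg-≤ u) (≤-reflexive (fiber-quotient V d u)))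
    (indeg-≤ M (crowd-penalised g M) u)) degree-bound
  robust .heavy F fas = +-cancelʳ-< (3 * (T * V)) _ _ (begin-strict
    a + Δ + 3 * (T * V)              ≡⟨ +-assoc a Δ _ ⟩
    a + (Δ + 3 * (T * V))            ≤⟨ +-monoʳ-≤ a enough ⟩
    a + 2 * a                        <⟨ *-monoʳ-< 3
        (fas-bound {k} {N} refl (T * V) (proj₂ (proj₂ found)) F fas) ⟩
    3 * (size thinned F + T * V)     ≡⟨ *-distribˡ-+ 3 (size thinned F) (T * V) ⟩
    3 * size thinned F + 3 * (T * V) ∎)
    where
    a = numArcs thinned
    rearrange₁ : ∀ T n Δ → Δ + 3 * (T * n) + 2 * n ≡ Δ + n * (3 * T + 2)
    rearrange₁ = solve-∀
    rearrange₂ : ∀ T n → n * 2 + n * (3 * T + 2) ≡ n * (3 * T + 4)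
    rearrange₂ = solve-∀
    rearrange₃ : ∀ n d → n * (2 * d) ≡ 2 * (n * d)
    rearrange₃ = solve-∀
    Δ≤ : Δ ≤ V * 2
    Δ≤ = ≤-trans (≤-trans (m≤n+m Δ _) (≤-trans (n≤1+n _) N≤V)) (m≤m*n V 2)
    enough : Δ + 3 * (T * V) ≤ 2 * a
    enough = +-cancelʳ-≤ (2 * V) _ _ (begin
      Δ + 3 * (T * V) + 2 * V        ≡⟨ rearrange₁ T V Δ ⟩
      Δ + V * (3 * T + 2)            ≤⟨ +-monoˡ-≤ _ Δ≤ ⟩
      V * 2 + V * (3 * T + 2)        ≡⟨ rearrange₂ T V ⟩
      V * (3 * T + 4)                ≤⟨ *-monoʳ-≤ V few-ascents ⟩
      V * (2 * d)                    ≡⟨ rearrange₃ V d ⟩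
      2 * (V * d)                    ≤⟨ *-monoʳ-≤ 2 many ⟩
      2 * (a + V)                    ≡⟨ *-distribˡ-+ 2 a V ⟩
      2 * a + 2 * V                  ∎)

-- A pendant arc out of `u₀` raises its degree by one and creates no directed cycle.
module Leaf (D : Digraph) (u₀ : Fin (order D)) where

  addLeaf : Digraph
  addLeaf = record
    { n   = suc (order D)
    ; adj = λ { zero    _       → false
              ; (suc u) zero    → does (u₀ Fin.≟ u)
              ; (suc u) (suc v) → adj D u v } }

  outdeg-leaf : outdeg addLeaf zero ≡ 0
  outdeg-leaf = trans (count≡sum (adj addLeaf zero)) (trans (sum-const (suc (order D)) 0) (*-zeroʳ (order D)))

  indeg-leaf : indeg addLeaf zero ≡ 1
  indeg-leaf = trans (count≡sum (λ u → adj addLeaf u zero))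
    (trans (sum-cong-≗ λ u → sym (*-identityʳ (χ (u₀ Fin.≟ u)))) (sum-δ u₀ (λ _ → 1)))

  outdeg-old : ∀ u → outdeg addLeaf (suc u) ≡ χ (u₀ Fin.≟ u) + outdeg D u
  outdeg-old u = trans (count≡sum (adj addLeaf (suc u)))
      (cong (χ (u₀ Fin.≟ u) +_) (sym (count≡sum (adj D u))))

  indeg-old : ∀ v → indeg addLeaf (suc v) ≡ indeg D v
  indeg-old v = trans (count≡sum (λ u → adj addLeaf u (suc v))) (sym (count≡sum (λ u → adj D u v)))

  deg-old : ∀ u → deg addLeaf (suc u) ≡ χ (u₀ Fin.≟ u) + deg D u
  deg-old u = trans (cong₂ _+_ (outdeg-old u) (indeg-old u)) (+-assoc (χ (u₀ Fin.≟ u)) _ _)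

  deg-leaf : deg addLeaf zero ≡ 1
  deg-leaf = cong₂ _+_ outdeg-leaf indeg-leaf

  deg-host : deg addLeaf (suc u₀) ≡ suc (deg D u₀)
  deg-host = trans (deg-old u₀) (cong (_+ deg D u₀) (χ-yes (u₀ Fin.≟ u₀) refl))

  numArcs-addLeaf : numArcs addLeaf ≡ suc (numArcs D)
  numArcs-addLeaf = begin
    numArcs addLeaf
      ≡⟨ list-sum (outdeg addLeaf) ⟩
    outdeg addLeaf zero + (∑[ u < order D ] outdeg addLeaf (suc u))
      ≡⟨ cong₂ _+_ outdeg-leaf (sum-cong-≗ outdeg-old) ⟩
    (∑[ u < order D ] χ (u₀ Fin.≟ u) + outdeg D u)
      ≡⟨ ∑-distrib-+ (λ u → χ (u₀ Fin.≟ u)) (outdeg D) ⟩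
    (∑[ u < order D ] χ (u₀ Fin.≟ u)) + sum (outdeg D)
      ≡⟨ cong₂ _+_ (trans (sum-cong-≗ λ u → sym (*-identityʳ (χ (u₀ Fin.≟ u)))) (sum-δ u₀ (λ _ → 1)))
          (sym (list-sum (outdeg D))) ⟩
    suc (numArcs D) ∎
    where open ≡-Reasoning

  old-arcs : ArcSubset addLeaf → ArcSubset D
  old-arcs F u v = F (suc u) (suc v)

  size-old-arcs : ∀ F → size D (old-arcs F) ≤ size addLeaf F
  size-old-arcs F = begin
    size D (old-arcs F)
      ≡⟨ size≡sum D (old-arcs F) ⟩
    (∑[ u < order D ] ∑[ v < order D ] χ (T? (F (suc u) (suc v))))
      ≤⟨ sum-mono (λ u → m≤n+m _ (χ (T? (F (suc u) zero)))) ⟩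
    (∑[ u < order D ] ∑[ v < suc (order D) ] χ (T? (F (suc u) v)))
      ≤⟨ m≤n+m _ (∑[ v < suc (order D) ] χ (T? (F zero v))) ⟩
    (∑[ u < suc (order D) ] ∑[ v < suc (order D) ] χ (T? (F u v)))
      ≡⟨ size≡sum addLeaf F ⟨
    size addLeaf F ∎
    where open ≤-Reasoning

  old-fas : ∀ F → IsFAS addLeaf F → IsFAS D (old-arcs F)
  old-fas F (sub , acyclic) = (λ u v → sub (suc u) (suc v)) , λ k →
      acyclic k ∘ mapCycle suc Fin.suc-injective id k

  -- The leaf has no out-arc, so every directed cycle lives on the old vertices.
  old-cycle : ∀ k → DirCycle (Arc addLeaf) k → DirCycle (Arc D) k
  old-cycle (suc l) (w , inj , steps , close) =
    proj₁ ∘ old , (λ {i} {j} eq → inj (trans (proj₂ (old i)) (trans (cong suc eq) (sym (proj₂ (old j)))))) ,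
    (λ i → subst₂ (Arc addLeaf) (proj₂ (old (inject₁ i))) (proj₂ (old (suc i))) (steps i)) ,
    subst₂ (Arc addLeaf) (proj₂ (old (fromℕ l))) (proj₂ (old zero)) close
    where
    isOld : ∀ u v → Arc addLeaf u v → ∃ λ u′ → u ≡ suc u′
    isOld (suc u) v _ = u , refl
    old : ∀ t → ∃ λ u′ → w t ≡ suc u′
    old t = isOld (w t) (w (next t)) (cycle-step {R = Arc addLeaf} w steps close t)

  -- The new arc uses one unit of slack; a feedback arc set restricted to the old vertices is still
  -- one and has not grown.
  addLeaf-robust : ∀ {g Δ slack} → deg D u₀ < Δ → Robust g Δ (suc slack) D → Robust g Δ slack addLeaf
  addLeaf-robust                 room R .girth k        = girth R k ∘ old-cycle k
  addLeaf-robust                 room R .degrees zero    = ≤-trans (≤-reflexive deg-leaf) (≤-<-trans z≤n room)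
  addLeaf-robust {Δ = Δ}         room R .degrees (suc u) =
      ≤-trans (≤-reflexive (deg-old u)) (bound (u₀ Fin.≟ u))
    where
    bound : (d : Dec (u₀ ≡ u)) → χ d + deg D u ≤ Δ
    bound (yes refl) = room
    bound (no _)     = degrees R u
  addLeaf-robust {slack = slack} room R .heavy F fas = begin-strict
    numArcs addLeaf + slack           ≡⟨ cong (_+ slack) numArcs-addLeaf ⟩
    suc (numArcs D + slack)           ≡⟨ +-suc (numArcs D) slack ⟨
    numArcs D + suc slack             <⟨ heavy R (old-arcs F) (old-fas F fas) ⟩
    3 * size D (old-arcs F)           ≤⟨ *-monoʳ-≤ 3 (size-old-arcs F) ⟩
    3 * size addLeaf F                ∎
    where open ≤-Reasoning

open Leaf

-- `e` is the degree still missing at `u₀`; each pendant arc lowers it by one at the cost of one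
-- unit of slack.
saturate : ∀ {g Δ slack} e D (u₀ : Fin (order D)) → e + deg D u₀ ≡ Δ → Robust g Δ (e + slack) D →
           ∃ λ D′ → Robust g Δ slack D′ × ∃ λ u → deg D′ u ≡ Δ
saturate zero    D u₀ eq R = D , R , u₀ , eq
saturate (suc e) D u₀ eq R = saturate e (addLeaf D u₀) (suc u₀)
  (trans (cong (e +_) (deg-host D u₀)) (trans (+-suc e (deg D u₀)) eq))
  (addLeaf-robust D u₀ (≤-trans (s≤s (m≤n+m (deg D u₀) e)) (≤-reflexive eq)) R)

saturated : ∀ {g Δ} → (∃ λ D → Robust g Δ Δ D × Fin (order D)) → ∃ λ D →
    GirthAtLeast D g × MaxDegreeEq D Δ × FasGtThird D
saturated {g} {Δ} (D , R , u₀)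
  -- The slack `Δ` splits into the missing degree, which is spent, and `deg D u₀`, which is left
  -- over.
  with saturate (Δ ∸ deg D u₀) D u₀ (m∸n+n≡m (degrees R u₀))
      (subst (λ slack → Robust g Δ slack D) (sym (m∸n+n≡m (degrees R u₀))) R)
... | D′ , R′ , full = D′ , girth R′ , (degrees R′ , full) , λ F fas → ≤-<-trans (m≤m+n _ _) (heavy R′ F fas)

-- Decompositions into feedback arc sets

-- `φ` is a potential: it never drops along the path, so the closing arc cannot raise it back to its
-- initial value.
increasing⇒acyclic : {R : Fin n → Fin n → Set} (φ : Fin n → ℕ) → (∀ {u v} → R u v → φ u < φ v) → Acyclic R
increasing⇒acyclic {n} {R} φ mono (suc l) (w , _ , steps , close) =
  <-irrefl refl (≤-<-trans (climb l w steps) (mono close))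
  where
  climb : ∀ l (w : Fin (suc l) → Fin n) → (∀ (i : Fin l) → R (w (inject₁ i)) (w (suc i))) →
      φ (w zero) ≤ φ (w (fromℕ l))
  climb zero    w steps = ≤-refl
  climb (suc l) w steps = ≤-trans (<⇒≤ (mono (steps zero))) (climb l (w ∘ suc) (steps ∘ suc))

T-∧ˡ : ∀ x {y} → T (x ∧ y) → T x
T-∧ˡ true _ = _

T-∧ : ∀ {x y} → T x → T y → T (x ∧ y)
T-∧ {true} _ y = y

-- Split the arcs by the numbering of the vertices: removing either class leaves arcs that all point
-- the same way.
forward-backward : ∀ D → Oriented D → FASPartition D 2
forward-backward D (noLoop , _) = class , λ i → (λ u v → T-∧ˡ (adj D u v)) , acyclic i
  where
  class : Fin (order D) → Fin (order D) → Fin 2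
  class u v = if does (u Fin.<? v) then zero else suc zero
  forward : ∀ {u v} → u Fin.< v → class u v ≡ zero
  forward {u} {v} u<v = cong (if_then zero else suc zero) (dec-true (u Fin.<? v) u<v)
  backward : ∀ {u v} → ¬ u Fin.< v → class u v ≡ suc zero
  backward {u} {v} u≮v = cong (if_then zero else suc zero) (dec-false (u Fin.<? v) u≮v)
  acyclic : ∀ i → Acyclic (λ u v → Arc D u v × ¬ T (adj D u v ∧ ⌊ class u v Fin.≟ i ⌋))
  acyclic zero = increasing⇒acyclic (λ u → order D ∸ toℕ u) descends
    where
    descends : ∀ {u v} → Arc D u v × ¬ T (adj D u v ∧ ⌊ class u v Fin.≟ zero ⌋) →
        order D ∸ toℕ u < order D ∸ toℕ v
    descends {u} {v} (a , ∉) with Fin.<-cmp u v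
    ... | tri< u<v _ _  = contradiction (T-∧ a (fromWitness (forward u<v))) ∉
    ... | tri≈ _ refl _ = contradiction a (noLoop u)
    ... | tri> _ _ v<u  = ∸-monoʳ-< v<u (Fin.toℕ≤n u)
  acyclic (suc zero) = increasing⇒acyclic toℕ ascends
    where
    ascends : ∀ {u v} → Arc D u v × ¬ T (adj D u v ∧ ⌊ class u v Fin.≟ suc zero ⌋) → toℕ u < toℕ v
    ascends {u} {v} (a , ∉) = decidable-stable (u Fin.<? v) λ u≮v → ∉ (T-∧ a (fromWitness (backward u≮v)))

-- Each class holds more than a third of the arcs, so three disjoint classes would hold more arcs
-- than there are.
fasGtThird⇒fasd≤2 : ∀ D → FasGtThird D → FasdAtMost D 2
fasGtThird⇒fasd≤2 D heavy zero             _           = z≤n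
fasGtThird⇒fasd≤2 D heavy (suc zero)       _           = s≤s z≤n
fasGtThird⇒fasd≤2 D heavy (suc (suc zero)) _           = ≤-refl
fasGtThird⇒fasd≤2 D heavy (suc (suc (suc j))) (c , isFAS) = contradiction three-classes (<⇒≱ too-heavy)
  where
  open ≤-Reasoning
  i₀ i₁ i₂ : Fin (3 + j)
  i₀ = zero
  i₁ = suc zero
  i₂ = suc (suc zero)
  class : Fin (3 + j) → ArcSubset D
  class i u v = adj D u v ∧ ⌊ c u v Fin.≟ i ⌋
  s : Fin (3 + j) → ℕ
  s i = size D (class i)
  x : Fin (3 + j) → Fin (order D) → Fin (order D) → ℕ
  x i u v = χ (T? (class i u v))
  pointwise : ∀ a (p : Fin (3 + j)) →
    χ (T? (a ∧ ⌊ p Fin.≟ i₀ ⌋)) + χ (T? (a ∧ ⌊ p Fin.≟ i₁ ⌋)) + χ (T? (a ∧ ⌊ p Fin.≟ i₂ ⌋)) ≤ χ (T? a)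
  pointwise false _                   = z≤n
  pointwise true  zero                = ≤-refl
  pointwise true  (suc zero)          = ≤-refl
  pointwise true  (suc (suc zero))    = ≤-refl
  pointwise true  (suc (suc (suc _))) = z≤n
  three-classes : s i₀ + s i₁ + s i₂ ≤ numArcs D
  three-classes = begin
    s i₀ + s i₁ + s i₂
      ≡⟨ cong₂ _+_ (cong₂ _+_ (size≡sum D (class i₀)) (size≡sum D (class i₁))) (size≡sum D (class i₂)) ⟩
    (∑[ u < order D ] sum (x i₀ u)) + (∑[ u < order D ] sum (x i₁ u)) + (∑[ u < order D ] sum (x i₂ u))
      ≡⟨ cong (_+ (∑[ u < order D ] sum (x i₂ u))) (∑-distrib-+ (λ u → sum (x i₀ u)) (λ u → sum (x i₁ u))) ⟨
    (∑[ u < order D ] sum (x i₀ u) + sum (x i₁ u)) + (∑[ u < order D ] sum (x i₂ u))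
      ≡⟨ ∑-distrib-+ (λ u → sum (x i₀ u) + sum (x i₁ u)) (λ u → sum (x i₂ u)) ⟨
    (∑[ u < order D ] sum (x i₀ u) + sum (x i₁ u) + sum (x i₂ u))
      ≡⟨ sum-cong-≗ (λ u → trans (∑-distrib-+ (λ v → x i₀ u v + x i₁ u v) (x i₂ u))
          (cong (_+ sum (x i₂ u)) (∑-distrib-+ (x i₀ u) (x i₁ u)))) ⟨
    (∑[ u < order D ] ∑[ v < order D ] x i₀ u v + x i₁ u v + x i₂ u v)
      ≤⟨ sum-mono (λ u → sum-mono λ v → pointwise (adj D u v) (c u v)) ⟩
    (∑[ u < order D ] ∑[ v < order D ] χ (T? (adj D u v)))
      ≡⟨ size≡sum D (adj D) ⟨
    numArcs D ∎
  too-heavy : numArcs D < s i₀ + s i₁ + s i₂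
  too-heavy = *-cancelˡ-< 3 _ _ (begin-strict
    3 * numArcs D                          ≡⟨ rearrange₁ (numArcs D) ⟩
    numArcs D + numArcs D + numArcs D      <⟨ +-mono-<
        (+-mono-< (heavy (class i₀) (isFAS i₀)) (heavy (class i₁) (isFAS i₁))) (heavy (class i₂) (isFAS i₂)) ⟩
    3 * s i₀ + 3 * s i₁ + 3 * s i₂         ≡⟨ rearrange₂ (s i₀) (s i₁) (s i₂) ⟩
    3 * (s i₀ + s i₁ + s i₂)               ∎)
    where
    rearrange₁ : ∀ a → 3 * a ≡ a + a + a
    rearrange₁ = solve-∀
    rearrange₂ : ∀ a b c → 3 * a + 3 * b + 3 * c ≡ 3 * (a + b + c)
    rearrange₂ = solve-∀

-- The full arc set is a feedback arc set; without arcs the hypothesis would read 0 < 0 for it.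
fasGtThird⇒nonempty : ∀ D → FasGtThird D → 0 < numArcs D
fasGtThird⇒nonempty D heavy = n≢0⇒n>0 λ empty →
  <-irrefl (trans empty (sym (cong (3 *_) empty)))
      (heavy (adj D) ((λ _ _ a → a) , λ { (suc k) (_ , _ , _ , a , ∉) → ∉ a }))

-- The extremal digraphs and the theorem

-- The evaluated inequality is 2 · 8^8 · (9 · 10 ⋯ 16)^128 < 8^1024 · 2^672.
extremal : ∀ g → ∃ λ D → GirthAtLeast D g × MaxDegreeEq D 1362 × FasGtThird D
extremal g = saturated (robustDigraph g 1362 128 8 84 ≤-refl (m≤m+n 772 590) (<ᵇ⇒< _ _ _))

-- One admissible digraph with fas > a/3 puts the supremum above 1/3. That the minimum is 2 combines
-- a partition into two classes for every admissible digraph with one admissible digraph that allows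
-- no more.
theorem8 : (g : ℕ) → 3 ≤ g →
    (∃ λ D → Oriented D × MaxDegreeEq D 1362 × FasGtThird D × GirthAtLeast D g)
    × (∃ λ D → Admissible 1362 g D × FasGtThird D)
    × ((∀ D → Admissible 1362 g D → FasdAtLeast D 2)
    × (∃ λ D → Admissible 1362 g D × FasdAtMost D 2))
theorem8 g 3≤g = conclude (extremal g)
  where
  conclude : (∃ λ D → GirthAtLeast D g × MaxDegreeEq D 1362 × FasGtThird D) → _
  conclude (D , girth , (degrees , full) , heavy) =
    (D , oriented , (degrees , full) , heavy , girth) ,
    (D , admissible , heavy) ,
    (λ D′ adm → forward-backward D′ (proj₁ adm)) ,
    (D , admissible , fasGtThird⇒fasd≤2 D heavy)
    where
    oriented : Oriented D
    oriented = girth≥3⇒oriented D 3≤g girth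
    admissible : Admissible 1362 g D
    admissible = oriented , fasGtThird⇒nonempty D heavy , degrees , girth
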